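{- Any $\varepsilon$-edge-differentially private algorithm to compute 1. the number of high-degree nodes, 2. the degree histogram, 3. the number of edges, 4. the number of triangles, or 5. the number of $k$-stars in an incremental graph sequence of length $T$ must have additive error $\Omega(\log T)$, even with $\varepsilon=1$.
   Context: Graphs are undirected. An incremental graph sequence $(G_1,\dots,G_T)$ arises from an initial (possibly non-empty) graph $G_0$ by inserting at each time $t$ a set $\partial V_t^+$ of nodes and a set $\partial E_t^+$ of edges (no deletions). Two incremental sequences are edge-adjacent (event-level) if they have the same length, initial graph and node insertions, and (up to exchanging them) there are an edge $e^*$ and a time $t^*$ with $\partial E_t^+=\partial E_t'^+$ for $t\ne t^*$, $\partial E_{t^*}'^+\subseteq\partial E_{t^*}^+$ and $\partial E_{t^*}^+\setminus\partial E_{t^*}'^+=\{e^*\}$. The algorithm is randomized and outputs after each time step an estimate of the value for the current graph. It is $\varepsilon$-edge-differentially private if $\Pr[\mathcal A(\mathcal G)\in S]\le e^\varepsilon\Pr[\mathcal A(\mathcal G')\in S]$ for all edge-adjacent $\mathcal G,\mathcal G'$ and all sets $S$ of possible output sequences. The additive error at a time step is the difference between the output and the true value. High-degree nodes are the nodes of degree at least a given threshold $\tau$. The degree histogram records, for each $i$, the number of nodes of degree $i$. A $k$-star is a center node together with $k$ of its neighbors. -}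

module Defs where

open import Data.Fin as Fin using (Fin; toℕ)
open import Data.Fin.Properties using (toℕ-injective)
open import Data.Integer using (+_)
import Data.Integer as ℤ
import Data.Integer.Properties as ℤ
open import Data.List using (List; []; _∷_; _++_; map; concatMap; filter; length; cartesianProduct)
open import Data.List.Membership.Propositional using (_∈_; _∉_)
open import Data.List.Relation.Binary.BagAndSetEquality using (_∼[_]_; set)
open import Data.List.Relation.Binary.Subset.Propositional using (_⊆_)
open import Data.List.Relation.Unary.Any using (Any; any?)
open import Data.List.Relation.Unary.Unique.Propositional using (Unique)
open import Data.Nat as ℕ using (ℕ; zero; suc)
import Data.Nat.Properties as ℕ
open import Data.Product using (∃; ∃-syntax; _×_; _,_; proj₁; proj₂)
open import Data.Rational as ℚ using (ℚ; 0ℚ; 1ℚ; ½; ∣_∣; _+_; _-_; _*_; -_; _≤_; _<_; _/_)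
import Data.Rational.Properties as ℚ
open import Data.Rational.Solver using (module +-*-Solver)
import Data.Rational.Unnormalised as ℚᵘ
import Data.Rational.Unnormalised.Properties as ℚᵘ
open import Data.Sum using (_⊎_; inj₁; inj₂)
open import Data.Unit using (⊤)
open import Function using (_∘_)
open import Function.Bundles using (_⇔_; _↣_; mk↣)
open import Function.Construct.Identity using (↣-id)
open import Level using (0ℓ)
open import Relation.Binary.PropositionalEquality
open import Relation.Nullary using (¬_; Dec; _×-dec_; _⊎-dec_)
open import Relation.Unary using (Pred; ∁; ⋃; ⋂)

ℕ→ℚ : ℕ → ℚ
ℕ→ℚ n = + n / 1

module RationalLemmas where

  inv : ℕ → ℚ
  inv n = + 1 / suc n

  fromᵘ : ∀ p q → ℚᵘ._≃_ (ℚ.toℚᵘ p) q → p ≡ ℚ.fromℚᵘ q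
  fromᵘ p q e = trans (sym (ℚ.fromℚᵘ-toℚᵘ p)) (ℚ.fromℚᵘ-cong e)

  ℕ→ℚ-suc : ∀ n → ℕ→ℚ (suc n) ≡ 1ℚ + ℕ→ℚ n
  ℕ→ℚ-suc n = sym (fromᵘ (1ℚ + ℕ→ℚ n) (ℚᵘ.mkℚᵘ (+ suc n) 0)
    (ℚᵘ.≃-trans (ℚ.toℚᵘ-homo-+ 1ℚ (ℕ→ℚ n))
      (ℚᵘ.≃-trans (ℚᵘ.+-congʳ (ℚ.toℚᵘ 1ℚ) (ℚ.toℚᵘ-fromℚᵘ (ℚᵘ.mkℚᵘ (+ n) 0)))
        (ℚᵘ.*≡* (cong (λ k → (+ 1 ℤ.+ k) ℤ.* + 1) (ℤ.*-identityʳ (+ n)))))))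

  ℕ→ℚ-inv : ∀ n → ℕ→ℚ (suc n) * inv n ≡ 1ℚ
  ℕ→ℚ-inv n = fromᵘ (ℕ→ℚ (suc n) * inv n) ℚᵘ.1ℚᵘ
    (ℚᵘ.≃-trans (ℚ.toℚᵘ-homo-* (ℕ→ℚ (suc n)) (inv n))
      (ℚᵘ.≃-trans (ℚᵘ.*-cong (ℚ.toℚᵘ-fromℚᵘ (ℚᵘ.mkℚᵘ (+ suc n) 0)) (ℚ.toℚᵘ-fromℚᵘ (ℚᵘ.mkℚᵘ (+ 1) n)))
        (ℚᵘ.*≡* (cong +_ (trans (ℕ.*-identityʳ (suc n ℕ.* 1)) (trans (ℕ.*-identityʳ (suc n))
           (sym (trans (ℕ.+-identityʳ _) (ℕ.+-identityʳ (suc n))))))))))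

  archimedean : ∀ p → ∃[ N ] p ≤ ℕ→ℚ N
  archimedean p = ℤ.∣ ℚ.↥ p ∣ , ℚ.toℚᵘ-cancel-≤
    (ℚᵘ.≤-respʳ-≃ (ℚᵘ.≃-sym (ℚ.toℚᵘ-fromℚᵘ (ℚᵘ.mkℚᵘ (+ ℤ.∣ ℚ.↥ p ∣) 0))) (ℚᵘ.*≤* (lem p)))
    where
    open ℤ.≤-Reasoning
    lem : ∀ p → ℚᵘ.↥ (ℚ.toℚᵘ p) ℤ.* + 1 ℤ.≤ + ℤ.∣ ℚ.↥ p ∣ ℤ.* ℚᵘ.↧ (ℚ.toℚᵘ p)
    lem (ℚ.mkℚ (+ n) d _) = begin
      + n ℤ.* + 1       ≡⟨ ℤ.*-identityʳ (+ n) ⟩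
      + n               ≤⟨ ℤ.+≤+ (ℕ.m≤m*n n (suc d)) ⟩
      + (n ℕ.* suc d)   ≡⟨ ℤ.pos-* n (suc d) ⟩
      + n ℤ.* + suc d   ∎
    lem (ℚ.mkℚ (ℤ.-[1+ n ]) d _) = ℤ.-≤+

  inv-pos : ∀ n → 0ℚ < inv n
  inv-pos n = ℚ.positive⁻¹ (inv n) {{ℚ.normalize-pos 1 (suc n)}}

  ℕ→ℚ-nonneg : ∀ n → 0ℚ ≤ ℕ→ℚ n
  ℕ→ℚ-nonneg n = ℚ.nonNegative⁻¹ (ℕ→ℚ n) {{ℚ.normalize-nonNeg n 1}}

  ℕ→ℚ-step : ∀ n → ℕ→ℚ n ≤ ℕ→ℚ (suc n)
  ℕ→ℚ-step n = subst₂ _≤_ (ℚ.+-identityˡ _) (sym (ℕ→ℚ-suc n))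
    (ℚ.+-monoˡ-≤ (ℕ→ℚ n) (ℚ.<⇒≤ (ℚ.positive⁻¹ 1ℚ)))

  ℕ→ℚ-mono′ : ∀ {m n} → m ℕ.≤′ n → ℕ→ℚ m ≤ ℕ→ℚ n
  ℕ→ℚ-mono′ (ℕ.≤′-reflexive refl) = ℚ.≤-refl
  ℕ→ℚ-mono′ (ℕ.≤′-step {n} p) = ℚ.≤-trans (ℕ→ℚ-mono′ p) (ℕ→ℚ-step n)

  ℕ→ℚ-mono : ∀ {m n} → m ℕ.≤ n → ℕ→ℚ m ≤ ℕ→ℚ n
  ℕ→ℚ-mono = ℕ→ℚ-mono′ ∘ ℕ.≤⇒≤′

  *-monoʳ : ∀ {p q} r → 0ℚ ≤ r → p ≤ q → p * r ≤ q * r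
  *-monoʳ r 0≤r = ℚ.*-monoʳ-≤-nonNeg r {{ℚ.nonNegative 0≤r}}

  *-mono : ∀ {p q r s} → 0ℚ ≤ r → 0ℚ ≤ q → p ≤ q → r ≤ s → p * r ≤ q * s
  *-mono {q = q} {r} 0≤r 0≤q p≤q r≤s =
    ℚ.≤-trans (*-monoʳ r 0≤r p≤q) (ℚ.*-monoˡ-≤-nonNeg q {{ℚ.nonNegative 0≤q}} r≤s)

  *-nonneg : ∀ {p q} → 0ℚ ≤ p → 0ℚ ≤ q → 0ℚ ≤ p * q
  *-nonneg {p} {q} 0≤p 0≤q = subst (_≤ p * q) (ℚ.*-zeroˡ q) (*-monoʳ q 0≤q 0≤p)

  *-pos : ∀ {p q} → 0ℚ < p → 0ℚ < q → 0ℚ < p * q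
  *-pos {p} {q} 0<p 0<q = ℚ.positive⁻¹ (p * q)
    {{ℚ.pos*pos⇒pos p {{ℚ.positive 0<p}} q {{ℚ.positive 0<q}}}}

  +-nonneg : ∀ {p q} → 0ℚ ≤ p → 0ℚ ≤ q → 0ℚ ≤ p + q
  +-nonneg 0≤p 0≤q = ℚ.+-mono-≤ 0≤p 0≤q

  half-pos : ∀ {δ} → 0ℚ < δ → 0ℚ < δ * ½
  half-pos 0<δ = *-pos 0<δ (ℚ.positive⁻¹ ½)

  halves : ∀ δ → δ * ½ + δ * ½ ≡ δ
  halves δ = trans (sym (ℚ.*-distribˡ-+ δ ½ ½)) (ℚ.*-identityʳ δ)

  reciprocal : ∀ b → 0ℚ < b → ∃[ r ] (0ℚ < r × b * r ≡ 1ℚ)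
  reciprocal b 0<b = r , ℚ.positive⁻¹ r {{ℚ.1/pos⇒pos b {{ℚ.positive 0<b}}}} , ℚ.*-inverseʳ b {{nz}}
    where
    nz : ℚ.NonZero b
    nz = ℚ.pos⇒nonZero b {{ℚ.positive 0<b}}
    r : ℚ
    r = ℚ.1/_ b {{nz}}

  archimedean′ : ∀ c δ → 0ℚ < δ → ∃[ N ] c ≤ δ * ℕ→ℚ N
  archimedean′ c δ 0<δ with reciprocal δ 0<δ
  ... | r , 0<r , δr≡1 with archimedean (r * c)
  ... | N , rc≤N = N , subst (_≤ δ * ℕ→ℚ N)
        (trans (sym (ℚ.*-assoc δ r c)) (trans (cong (_* c) δr≡1) (ℚ.*-identityˡ c)))
        (ℚ.*-monoˡ-≤-nonNeg δ {{ℚ.nonNegative (ℚ.<⇒≤ 0<δ)}} rc≤N)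

  ≤∣∣ : ∀ p → p ≤ ∣ p ∣
  ≤∣∣ p with ℚ.≤-total 0ℚ p
  ... | inj₁ 0≤p = ℚ.≤-reflexive (sym (ℚ.0≤p⇒∣p∣≡p 0≤p))
  ... | inj₂ p≤0 = ℚ.≤-trans p≤0 (ℚ.0≤∣p∣ p)

  ∣∣≤ : ∀ {p r} → p ≤ r → - p ≤ r → ∣ p ∣ ≤ r
  ∣∣≤ {p} p≤r -p≤r with ℚ.∣p∣≡p∨∣p∣≡-p p
  ... | inj₁ e rewrite e = p≤r
  ... | inj₂ e rewrite e = -p≤r

  ∣-∣-comm : ∀ p q → ∣ p - q ∣ ≡ ∣ q - p ∣
  ∣-∣-comm p q = trans (sym (ℚ.∣-p∣≡∣p∣ (p - q))) (cong ∣_∣ (solve 2 (λ p q → :- (p :- q) := q :- p) refl p q))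
    where open +-*-Solver

  move : ∀ {p q r} → p ≤ q + r → p - r ≤ q
  move {p} {q} {r} h = subst (p - r ≤_) (solve 2 (λ q r → q :+ r :- r := q) refl q r) (ℚ.+-monoˡ-≤ (- r) h)
    where open +-*-Solver

  ∣∣-lower : ∀ p q → ∣ p ∣ ≤ ∣ p - q ∣ + ∣ q ∣
  ∣∣-lower p q = subst (λ z → ∣ z ∣ ≤ ∣ p - q ∣ + ∣ q ∣)
    (solve 2 (λ p q → p :- q :+ q := p) refl p q) (ℚ.∣p+q∣≤∣p∣+∣q∣ (p - q) q)
    where open +-*-Solver

  reverse-triangle : ∀ p q → ∣ ∣ p ∣ - ∣ q ∣ ∣ ≤ ∣ p - q ∣
  reverse-triangle p q = ∣∣≤ (move (∣∣-lower p q))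
    (subst₂ _≤_ (solve 2 (λ p q → q :- p := :- (p :- q)) refl ∣ p ∣ ∣ q ∣) (∣-∣-comm q p) (move (∣∣-lower q p)))
    where open +-*-Solver

open RationalLemmas

IsCauchy : (ℕ → ℚ) → Set
IsCauchy s = ∀ δ → 0ℚ < δ → ∃[ N ] ∀ m n → N ℕ.≤ m → N ℕ.≤ n → ∣ s m - s n ∣ ≤ δ

record ℝ : Set where
  constructor mkℝ
  field
    seq    : ℕ → ℚ
    cauchy : IsCauchy seq

open ℝ public

infix  4 _≤ℝ_ _<ℝ_ _≃ℝ_
infixl 6 _+ℝ_ _-ℝ_
infixl 7 _*ℝ_

_≤ℝ_ : ℝ → ℝ → Set
x ≤ℝ y = ∀ δ → 0ℚ < δ → ∃[ N ] ∀ n → N ℕ.≤ n → seq x n ≤ seq y n + δ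

_<ℝ_ : ℝ → ℝ → Set
x <ℝ y = ∃[ δ ] (0ℚ < δ × ∃[ N ] ∀ n → N ℕ.≤ n → seq x n + δ ≤ seq y n)

_≃ℝ_ : ℝ → ℝ → Set
x ≃ℝ y = x ≤ℝ y × y ≤ℝ x

ℚ→ℝ : ℚ → ℝ
ℚ→ℝ q = mkℝ (λ _ → q) λ δ 0<δ → 0 , λ _ _ _ _ →
  subst (λ z → ∣ z ∣ ≤ δ) (sym (ℚ.+-inverseʳ q)) (ℚ.<⇒≤ 0<δ)

ℕ→ℝ : ℕ → ℝ
ℕ→ℝ n = ℚ→ℝ (ℕ→ℚ n)

0ℝ 1ℝ : ℝ
0ℝ = ℚ→ℝ 0ℚ
1ℝ = ℚ→ℝ 1ℚ

_+ℝ_ : ℝ → ℝ → ℝ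
seq (x +ℝ y) n = seq x n + seq y n
cauchy (x +ℝ y) δ 0<δ with cauchy x (δ * ½) (half-pos 0<δ) | cauchy y (δ * ½) (half-pos 0<δ)
... | N₁ , h₁ | N₂ , h₂ = N₁ ℕ.+ N₂ , λ m n N≤m N≤n → begin
    ∣ (seq x m + seq y m) - (seq x n + seq y n) ∣
      ≡⟨ cong ∣_∣ (solve 4 (λ a b c d → (a :+ c) :- (b :+ d) := (a :- b) :+ (c :- d)) refl
           (seq x m) (seq x n) (seq y m) (seq y n)) ⟩
    ∣ (seq x m - seq x n) + (seq y m - seq y n) ∣
      ≤⟨ ℚ.∣p+q∣≤∣p∣+∣q∣ (seq x m - seq x n) (seq y m - seq y n) ⟩
    ∣ seq x m - seq x n ∣ + ∣ seq y m - seq y n ∣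
      ≤⟨ ℚ.+-mono-≤
           (h₁ m n (ℕ.≤-trans (ℕ.m≤m+n N₁ N₂) N≤m) (ℕ.≤-trans (ℕ.m≤m+n N₁ N₂) N≤n))
           (h₂ m n (ℕ.≤-trans (ℕ.m≤n+m N₂ N₁) N≤m) (ℕ.≤-trans (ℕ.m≤n+m N₂ N₁) N≤n)) ⟩
    δ * ½ + δ * ½
      ≡⟨ halves δ ⟩
    δ ∎
  where
  open ℚ.≤-Reasoning
  open +-*-Solver

-ℝ_ : ℝ → ℝ
seq (-ℝ x) n = - seq x n
cauchy (-ℝ x) δ 0<δ with cauchy x δ 0<δ
... | N , h = N , λ m n N≤m N≤n →
  subst (λ z → ∣ z ∣ ≤ δ) (solve 2 (λ a b → b :- a := :- a :- :- b) refl (seq x m) (seq x n)) (h n m N≤n N≤m)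
  where open +-*-Solver

_-ℝ_ : ℝ → ℝ → ℝ
x -ℝ y = x +ℝ (-ℝ y)

∣_∣ℝ : ℝ → ℝ
seq ∣ x ∣ℝ n = ∣ seq x n ∣
cauchy ∣ x ∣ℝ δ 0<δ with cauchy x δ 0<δ
... | N , h = N , λ m n N≤m N≤n → ℚ.≤-trans (reverse-triangle (seq x m) (seq x n)) (h m n N≤m N≤n)

module ProductLemmas where

  bounded : ∀ {s} → IsCauchy s → ∃[ B ] (0ℚ < B × ∃[ N ] ∀ n → N ℕ.≤ n → ∣ s n ∣ ≤ B)
  bounded {s} c with c 1ℚ (ℚ.positive⁻¹ 1ℚ)
  ... | N , h = 1ℚ + ∣ s N ∣ , ℚ.+-mono-<-≤ (ℚ.positive⁻¹ 1ℚ) (ℚ.0≤∣p∣ (s N)) , N , λ n N≤n →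
    ℚ.≤-trans (∣∣-lower (s n) (s N)) (ℚ.+-monoˡ-≤ ∣ s N ∣ (h n N N≤n ℕ.≤-refl))

  *-estimate : ∀ a b c d {A D} → ∣ a ∣ ≤ A → ∣ d ∣ ≤ D →
               ∣ a * b - c * d ∣ ≤ A * ∣ b - d ∣ + ∣ a - c ∣ * D
  *-estimate a b c d {A} {D} a≤A d≤D = begin
    ∣ a * b - c * d ∣                    ≡⟨ cong ∣_∣ (solve 4 (λ a b c d →
                                             a :* b :- c :* d := a :* (b :- d) :+ (a :- c) :* d) refl a b c d) ⟩
    ∣ a * (b - d) + (a - c) * d ∣        ≤⟨ ℚ.∣p+q∣≤∣p∣+∣q∣ (a * (b - d)) ((a - c) * d) ⟩
    ∣ a * (b - d) ∣ + ∣ (a - c) * d ∣    ≡⟨ cong₂ _+_ (ℚ.∣p*q∣≡∣p∣*∣q∣ a (b - d)) (ℚ.∣p*q∣≡∣p∣*∣q∣ (a - c) d) ⟩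
    ∣ a ∣ * ∣ b - d ∣ + ∣ a - c ∣ * ∣ d ∣ ≤⟨ ℚ.+-mono-≤ (*-monoʳ ∣ b - d ∣ (ℚ.0≤∣p∣ (b - d)) a≤A)
                                             (ℚ.*-monoˡ-≤-nonNeg ∣ a - c ∣ {{ℚ.∣-∣-nonNeg (a - c)}} d≤D) ⟩
    A * ∣ b - d ∣ + ∣ a - c ∣ * D        ∎
    where
    open ℚ.≤-Reasoning
    open +-*-Solver

  *-modulus : ∀ a b c d {A D r s e δ} → 0ℚ < A → 0ℚ < D → A * r ≡ 1ℚ → D * s ≡ 1ℚ → e + e ≡ δ →
              ∣ a ∣ ≤ A → ∣ d ∣ ≤ D → ∣ b - d ∣ ≤ r * e → ∣ a - c ∣ ≤ e * s →
              ∣ a * b - c * d ∣ ≤ δ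
  *-modulus a b c d {A} {D} {r} {s} {e} {δ} 0<A 0<D Ar≡1 Ds≡1 e+e≡δ a≤A d≤D b-d a-c = begin
    ∣ a * b - c * d ∣
      ≤⟨ *-estimate a b c d a≤A d≤D ⟩
    A * ∣ b - d ∣ + ∣ a - c ∣ * D
      ≤⟨ ℚ.+-mono-≤ (ℚ.*-monoˡ-≤-nonNeg A {{ℚ.nonNegative (ℚ.<⇒≤ 0<A)}} b-d) (*-monoʳ D (ℚ.<⇒≤ 0<D) a-c) ⟩
    A * (r * e) + e * s * D
      ≡⟨ cong₂ _+_ (sym (ℚ.*-assoc A r e)) (trans (ℚ.*-assoc e s D) (trans (ℚ.*-comm e (s * D)) (cong (_* e) (ℚ.*-comm s D)))) ⟩
    (A * r) * e + (D * s) * e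
      ≡⟨ cong₂ (λ u v → u * e + v * e) Ar≡1 Ds≡1 ⟩
    1ℚ * e + 1ℚ * e
      ≡⟨ cong₂ _+_ (ℚ.*-identityˡ e) (ℚ.*-identityˡ e) ⟩
    e + e
      ≡⟨ e+e≡δ ⟩
    δ ∎
    where open ℚ.≤-Reasoning

  *-cauchy : ∀ {x y} → IsCauchy x → IsCauchy y → IsCauchy (λ n → x n * y n)
  *-cauchy {x} {y} cx cy δ 0<δ = go₁ (bounded cx) (bounded cy)
    where
    Goal : Set
    Goal = ∃[ N ] ∀ m n → N ℕ.≤ m → N ℕ.≤ n → ∣ x m * y m - x n * y n ∣ ≤ δ

    module _ {A D r s e N₁ N₂} (0<A : 0ℚ < A) (0<D : 0ℚ < D) (Ar≡1 : A * r ≡ 1ℚ) (Ds≡1 : D * s ≡ 1ℚ)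
             (e+e≡δ : e + e ≡ δ)
             (bx : ∀ n → N₁ ℕ.≤ n → ∣ x n ∣ ≤ A) (by : ∀ n → N₂ ℕ.≤ n → ∣ y n ∣ ≤ D) where

      go₃ : ∃[ N ] (∀ m n → N ℕ.≤ m → N ℕ.≤ n → ∣ y m - y n ∣ ≤ r * e) →
            ∃[ N ] (∀ m n → N ℕ.≤ m → N ℕ.≤ n → ∣ x m - x n ∣ ≤ e * s) → Goal
      go₃ (N₃ , hy) (N₄ , hx) = (N₁ ℕ.+ N₂) ℕ.+ (N₃ ℕ.+ N₄) , λ m n N≤m N≤n →
        *-modulus (x m) (y m) (x n) (y n) 0<A 0<D Ar≡1 Ds≡1 e+e≡δ
          (bx m (ℕ.m+n≤o⇒m≤o N₁ (ℕ.m+n≤o⇒m≤o (N₁ ℕ.+ N₂) N≤m)))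
          (by n (ℕ.m+n≤o⇒n≤o N₁ (ℕ.m+n≤o⇒m≤o (N₁ ℕ.+ N₂) N≤n)))
          (hy m n (ℕ.m+n≤o⇒m≤o N₃ (ℕ.m+n≤o⇒n≤o (N₁ ℕ.+ N₂) N≤m)) (ℕ.m+n≤o⇒m≤o N₃ (ℕ.m+n≤o⇒n≤o (N₁ ℕ.+ N₂) N≤n)))
          (hx m n (ℕ.m+n≤o⇒n≤o N₃ (ℕ.m+n≤o⇒n≤o (N₁ ℕ.+ N₂) N≤m)) (ℕ.m+n≤o⇒n≤o N₃ (ℕ.m+n≤o⇒n≤o (N₁ ℕ.+ N₂) N≤n)))

    go₂ : ∀ {A D N₁ N₂} → 0ℚ < A → 0ℚ < D →
          (∀ n → N₁ ℕ.≤ n → ∣ x n ∣ ≤ A) → (∀ n → N₂ ℕ.≤ n → ∣ y n ∣ ≤ D) →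
          ∃[ r ] (0ℚ < r × A * r ≡ 1ℚ) → ∃[ s ] (0ℚ < s × D * s ≡ 1ℚ) → ∃[ e ] (0ℚ < e × e + e ≡ δ) → Goal
    go₂ 0<A 0<D bx by (r , 0<r , Ar≡1) (s , 0<s , Ds≡1) (e , 0<e , e+e≡δ) =
      go₃ 0<A 0<D Ar≡1 Ds≡1 e+e≡δ bx by (cy (r * e) (*-pos 0<r 0<e)) (cx (e * s) (*-pos 0<e 0<s))

    go₁ : ∃[ A ] (0ℚ < A × ∃[ N ] ∀ n → N ℕ.≤ n → ∣ x n ∣ ≤ A) →
          ∃[ D ] (0ℚ < D × ∃[ N ] ∀ n → N ℕ.≤ n → ∣ y n ∣ ≤ D) → Goal
    go₁ (A , 0<A , _ , bx) (D , 0<D , _ , by) =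
      go₂ 0<A 0<D bx by (reciprocal A 0<A) (reciprocal D 0<D) (δ * ½ , half-pos 0<δ , halves δ)

open ProductLemmas

_*ℝ_ : ℝ → ℝ → ℝ
x *ℝ y = mkℝ (λ n → seq x n * seq y n) (*-cauchy {seq x} {seq y} (cauchy x) (cauchy y))

∑ℝ : ℕ → (ℕ → ℝ) → ℝ
∑ℝ zero    f = 0ℝ
∑ℝ (suc n) f = ∑ℝ n f +ℝ f n

infix 4 _ConvergesTo_

_ConvergesTo_ : (ℕ → ℝ) → ℝ → Set
f ConvergesTo x = ∀ δ → 0ℚ < δ → ∃[ N ] ∀ n → N ℕ.≤ n → ∣ f n -ℝ x ∣ℝ ≤ℝ ℚ→ℝ δ

-- a ^ n / n !
expTerm : ℚ → ℕ → ℚ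
expTerm a zero    = 1ℚ
expTerm a (suc n) = expTerm a n * a * (+ 1 / suc n)

expSum : ℚ → ℕ → ℚ
expSum a zero    = 0ℚ
expSum a (suc n) = expSum a n + expTerm a n

module ExpLemmas where

  module Majorant (K : ℚ) (0≤K : 0ℚ ≤ K) where

    t M : ℕ → ℚ
    t = expTerm K
    M = expSum K

    inv≥0 : ∀ n → 0ℚ ≤ inv n
    inv≥0 n = ℚ.<⇒≤ (inv-pos n)

    t≥0 : ∀ n → 0ℚ ≤ t n
    t≥0 zero    = ℚ.<⇒≤ (ℚ.positive⁻¹ 1ℚ)
    t≥0 (suc n) = *-nonneg (*-nonneg (t≥0 n) 0≤K) (inv≥0 n)

    M≥0 : ∀ n → 0ℚ ≤ M n
    M≥0 zero    = ℚ.≤-refl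
    M≥0 (suc n) = +-nonneg (M≥0 n) (t≥0 n)

    t-suc : ∀ n → t n * K ≡ t (suc n) * ℕ→ℚ (suc n)
    t-suc n = sym (begin
      t n * K * inv n * ℕ→ℚ (suc n)   ≡⟨ solve 3 (λ a i k → a :* i :* k := a :* (k :* i)) refl (t n * K) (inv n) (ℕ→ℚ (suc n)) ⟩
      t n * K * (ℕ→ℚ (suc n) * inv n) ≡⟨ cong (t n * K *_) (ℕ→ℚ-inv n) ⟩
      t n * K * 1ℚ                     ≡⟨ ℚ.*-identityʳ _ ⟩
      t n * K                          ∎)
      where
      open ≡-Reasoning
      open +-*-Solver

    ∣*inv∣ : ∀ p n → ∣ p * inv n ∣ ≡ ∣ p ∣ * inv n
    ∣*inv∣ p n = trans (ℚ.∣p*q∣≡∣p∣*∣q∣ p (inv n)) (cong (∣ p ∣ *_) (ℚ.0≤p⇒∣p∣≡p (inv≥0 n)))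

    term≤ : ∀ {a} → ∣ a ∣ ≤ K → ∀ n → ∣ expTerm a n ∣ ≤ t n
    term≤ a≤K zero = ℚ.≤-refl
    term≤ {a} a≤K (suc n) = begin
      ∣ expTerm a n * a * inv n ∣     ≡⟨ trans (∣*inv∣ (expTerm a n * a) n) (cong (_* inv n) (ℚ.∣p*q∣≡∣p∣*∣q∣ (expTerm a n) a)) ⟩
      ∣ expTerm a n ∣ * ∣ a ∣ * inv n ≤⟨ *-monoʳ (inv n) (inv≥0 n) (*-mono (ℚ.0≤∣p∣ a) (t≥0 n) (term≤ a≤K n) a≤K) ⟩
      t n * K * inv n                  ∎
      where open ℚ.≤-Reasoning

    term-lip : ∀ {a b} → ∣ a ∣ ≤ K → ∣ b ∣ ≤ K → ∀ n →
               ∣ expTerm a (suc n) - expTerm b (suc n) ∣ ≤ ∣ a - b ∣ * t n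
    term-lip {a} {b} a≤K b≤K zero = ℚ.≤-reflexive (trans
      (cong ∣_∣ (solve 2 (λ a b → con 1ℚ :* a :* con 1ℚ :- con 1ℚ :* b :* con 1ℚ := a :- b) refl a b))
      (sym (ℚ.*-identityʳ ∣ a - b ∣)))
      where open +-*-Solver
    term-lip {a} {b} a≤K b≤K (suc n) = begin
      ∣ u * a * i - v * b * i ∣
        ≡⟨ cong ∣_∣ (solve 5 (λ u a v b i → u :* a :* i :- v :* b :* i := (a :* u :- b :* v) :* i) refl u a v b i) ⟩
      ∣ (a * u - b * v) * i ∣
        ≡⟨ ∣*inv∣ (a * u - b * v) (suc n) ⟩
      ∣ a * u - b * v ∣ * i
        ≤⟨ *-monoʳ i (inv≥0 (suc n)) (*-estimate a u b v a≤K (term≤ b≤K (suc n))) ⟩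
      (K * ∣ u - v ∣ + ∣ a - b ∣ * t (suc n)) * i
        ≤⟨ *-monoʳ i (inv≥0 (suc n)) (ℚ.+-monoˡ-≤ (∣ a - b ∣ * t (suc n))
             (ℚ.*-monoˡ-≤-nonNeg K {{ℚ.nonNegative 0≤K}} (term-lip a≤K b≤K n))) ⟩
      (K * (∣ a - b ∣ * t n) + ∣ a - b ∣ * t (suc n)) * i
        ≡⟨ solve 5 (λ K d s s′ i → (K :* (d :* s) :+ d :* s′) :* i := d :* (s :* K :+ s′) :* i) refl
             K ∣ a - b ∣ (t n) (t (suc n)) i ⟩
      ∣ a - b ∣ * (t n * K + t (suc n)) * i
        ≡⟨ cong (λ z → ∣ a - b ∣ * (z + t (suc n)) * i) (t-suc n) ⟩
      ∣ a - b ∣ * (t (suc n) * ℕ→ℚ (suc n) + t (suc n)) * i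
        ≡⟨ solve 4 (λ d s k i → d :* (s :* k :+ s) :* i := d :* s :* ((con 1ℚ :+ k) :* i)) refl
             ∣ a - b ∣ (t (suc n)) (ℕ→ℚ (suc n)) i ⟩
      ∣ a - b ∣ * t (suc n) * ((1ℚ + ℕ→ℚ (suc n)) * i)
        ≡⟨ cong (λ z → ∣ a - b ∣ * t (suc n) * (z * i)) (sym (ℕ→ℚ-suc (suc n))) ⟩
      ∣ a - b ∣ * t (suc n) * (ℕ→ℚ (suc (suc n)) * i)
        ≡⟨ cong (∣ a - b ∣ * t (suc n) *_) (ℕ→ℚ-inv (suc n)) ⟩
      ∣ a - b ∣ * t (suc n) * 1ℚ
        ≡⟨ ℚ.*-identityʳ _ ⟩
      ∣ a - b ∣ * t (suc n) ∎
      where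
      open ℚ.≤-Reasoning
      open +-*-Solver
      u v i : ℚ
      u = expTerm a (suc n)
      v = expTerm b (suc n)
      i = inv (suc n)

    sum-lip : ∀ {a b} → ∣ a ∣ ≤ K → ∣ b ∣ ≤ K → ∀ n → ∣ expSum a (suc n) - expSum b (suc n) ∣ ≤ ∣ a - b ∣ * M n
    sum-lip {a} {b} a≤K b≤K zero = ℚ.≤-reflexive (sym (ℚ.*-zeroʳ ∣ a - b ∣))
    sum-lip {a} {b} a≤K b≤K (suc n) = begin
      ∣ (S + u) - (S′ + v) ∣
        ≡⟨ cong ∣_∣ (solve 4 (λ S u S′ v → (S :+ u) :- (S′ :+ v) := (S :- S′) :+ (u :- v)) refl S u S′ v) ⟩
      ∣ (S - S′) + (u - v) ∣
        ≤⟨ ℚ.∣p+q∣≤∣p∣+∣q∣ (S - S′) (u - v) ⟩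
      ∣ S - S′ ∣ + ∣ u - v ∣
        ≤⟨ ℚ.+-mono-≤ (sum-lip a≤K b≤K n) (term-lip a≤K b≤K n) ⟩
      ∣ a - b ∣ * M n + ∣ a - b ∣ * t n
        ≡⟨ sym (ℚ.*-distribˡ-+ ∣ a - b ∣ (M n) (t n)) ⟩
      ∣ a - b ∣ * (M n + t n) ∎
      where
      open ℚ.≤-Reasoning
      open +-*-Solver
      S S′ u v : ℚ
      S  = expSum a (suc n)
      S′ = expSum b (suc n)
      u  = expTerm a (suc n)
      v  = expTerm b (suc n)

    tail≤ : ∀ {a} → ∣ a ∣ ≤ K → ∀ {n m} → n ℕ.≤′ m → ∣ expSum a m - expSum a n ∣ ≤ M m - M n
    tail≤ {a} a≤K {n} (ℕ.≤′-reflexive refl) = ℚ.≤-reflexive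
      (trans (cong ∣_∣ (ℚ.+-inverseʳ (expSum a n))) (sym (ℚ.+-inverseʳ (M n))))
    tail≤ {a} a≤K {n} (ℕ.≤′-step {m} n≤m) = begin
      ∣ (expSum a m + expTerm a m) - expSum a n ∣
        ≡⟨ cong ∣_∣ (solve 3 (λ S u S′ → (S :+ u) :- S′ := (S :- S′) :+ u) refl (expSum a m) (expTerm a m) (expSum a n)) ⟩
      ∣ (expSum a m - expSum a n) + expTerm a m ∣
        ≤⟨ ℚ.∣p+q∣≤∣p∣+∣q∣ (expSum a m - expSum a n) (expTerm a m) ⟩
      ∣ expSum a m - expSum a n ∣ + ∣ expTerm a m ∣
        ≤⟨ ℚ.+-mono-≤ (tail≤ a≤K n≤m) (term≤ a≤K m) ⟩
      (M m - M n) + t m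
        ≡⟨ solve 3 (λ S u S′ → (S :- S′) :+ u := (S :+ u) :- S′) refl (M m) (t m) (M n) ⟩
      (M m + t m) - M n ∎
      where
      open ℚ.≤-Reasoning
      open +-*-Solver

    n₀ : ℕ
    n₀ = proj₁ (archimedean (K + K))

    halving : ∀ n → n₀ ℕ.≤ n → t (suc n) + t (suc n) ≤ t n
    halving n n₀≤n = begin
      t n * K * inv n + t n * K * inv n ≡⟨ solve 3 (λ s K i → s :* K :* i :+ s :* K :* i := s :* ((K :+ K) :* i)) refl (t n) K (inv n) ⟩
      t n * ((K + K) * inv n)           ≤⟨ ℚ.*-monoˡ-≤-nonNeg (t n) {{ℚ.nonNegative (t≥0 n)}} (*-monoʳ (inv n) (inv≥0 n)
                                             (ℚ.≤-trans (proj₂ (archimedean (K + K))) (ℕ→ℚ-mono (ℕ.m≤n⇒m≤1+n n₀≤n)))) ⟩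
      t n * (ℕ→ℚ (suc n) * inv n)       ≡⟨ cong (t n *_) (ℕ→ℚ-inv n) ⟩
      t n * 1ℚ                           ≡⟨ ℚ.*-identityʳ (t n) ⟩
      t n                                ∎
      where
      open ℚ.≤-Reasoning
      open +-*-Solver

    t-dec : ∀ {n} → n₀ ℕ.≤′ n → t n ≤ t n₀
    t-dec (ℕ.≤′-reflexive refl) = ℚ.≤-refl
    t-dec (ℕ.≤′-step {n} p) = ℚ.≤-trans
      (subst (_≤ t (suc n) + t (suc n)) (ℚ.+-identityˡ _) (ℚ.+-monoˡ-≤ (t (suc n)) (t≥0 (suc n))))
      (ℚ.≤-trans (halving n (ℕ.≤′⇒≤ p)) (t-dec p))

    U-dec : ∀ {n m} → n₀ ℕ.≤ n → n ℕ.≤′ m → M m + (t m + t m) ≤ M n + (t n + t n)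
    U-dec n₀≤n (ℕ.≤′-reflexive refl) = ℚ.≤-refl
    U-dec {n} n₀≤n (ℕ.≤′-step {m} n≤m) = begin
      M m + t m + (t (suc m) + t (suc m)) ≤⟨ ℚ.+-monoʳ-≤ (M m + t m) (halving m (ℕ.≤-trans n₀≤n (ℕ.≤′⇒≤ n≤m))) ⟩
      M m + t m + t m                     ≡⟨ ℚ.+-assoc (M m) (t m) (t m) ⟩
      M m + (t m + t m)                   ≤⟨ U-dec n₀≤n n≤m ⟩
      M n + (t n + t n)                   ∎
      where open ℚ.≤-Reasoning

    M≤U : ∀ {n m} → n₀ ℕ.≤ n → n ℕ.≤ m → M m ≤ M n + (t n + t n)
    M≤U {n} {m} n₀≤n n≤m = ℚ.≤-trans
      (subst (_≤ M m + (t m + t m)) (ℚ.+-identityʳ (M m)) (ℚ.+-monoʳ-≤ (M m) (+-nonneg (t≥0 m) (t≥0 m))))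
      (U-dec n₀≤n (ℕ.≤⇒≤′ n≤m))

    C : ℚ
    C = M n₀ + (t n₀ + t n₀)

    M≤C : ∀ n → n₀ ℕ.≤ n → M n ≤ C
    M≤C n = M≤U ℕ.≤-refl

    t-small : ∀ δ → 0ℚ < δ → ∃[ n ] (n₀ ℕ.≤ n × t n ≤ δ)
    t-small δ 0<δ with archimedean′ (t n₀ * K) δ 0<δ
    ... | N , h = suc (n₀ ℕ.+ N) , ℕ.m≤n⇒m≤1+n (ℕ.m≤m+n n₀ N) , (begin
      t n * K * inv n                 ≤⟨ *-monoʳ (inv n) (inv≥0 n) (*-monoʳ K 0≤K (t-dec (ℕ.≤⇒≤′ (ℕ.m≤m+n n₀ N)))) ⟩
      t n₀ * K * inv n                ≤⟨ *-monoʳ (inv n) (inv≥0 n) h ⟩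
      δ * ℕ→ℚ N * inv n               ≤⟨ *-monoʳ (inv n) (inv≥0 n) (ℚ.*-monoˡ-≤-nonNeg δ {{ℚ.nonNegative (ℚ.<⇒≤ 0<δ)}}
                                           (ℕ→ℚ-mono (ℕ.m≤n⇒m≤1+n (ℕ.m≤n+m N n₀)))) ⟩
      δ * ℕ→ℚ (suc n) * inv n         ≡⟨ ℚ.*-assoc δ (ℕ→ℚ (suc n)) (inv n) ⟩
      δ * (ℕ→ℚ (suc n) * inv n)       ≡⟨ cong (δ *_) (ℕ→ℚ-inv n) ⟩
      δ * 1ℚ                           ≡⟨ ℚ.*-identityʳ δ ⟩
      δ                                ∎)
      where
      open ℚ.≤-Reasoning
      n : ℕ
      n = n₀ ℕ.+ N

  ∣-∣-triangle : ∀ p q r → ∣ p - r ∣ ≤ ∣ p - q ∣ + ∣ q - r ∣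
  ∣-∣-triangle p q r = subst (λ z → ∣ z ∣ ≤ ∣ p - q ∣ + ∣ q - r ∣)
    (solve 3 (λ p q r → (p :- q) :+ (q :- r) := p :- r) refl p q r) (ℚ.∣p+q∣≤∣p∣+∣q∣ (p - q) (q - r))
    where open +-*-Solver

  module ExpCauchy {s : ℕ → ℚ} {K N₁} (0<K : 0ℚ < K) (s≤K : ∀ n → N₁ ℕ.≤ n → ∣ s n ∣ ≤ K)
                   {δ} (0<δ : 0ℚ < δ) where

    open Majorant K (ℚ.<⇒≤ 0<K)

    Goal : Set
    Goal = ∃[ N ] ∀ m n → N ℕ.≤ m → N ℕ.≤ n → ∣ expSum (s m) m - expSum (s n) n ∣ ≤ δ

    C₁ : ℚ
    C₁ = 1ℚ + C

    0<C₁ : 0ℚ < C₁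
    0<C₁ = ℚ.+-mono-<-≤ (ℚ.positive⁻¹ 1ℚ) (+-nonneg (M≥0 n₀) (+-nonneg (t≥0 n₀) (t≥0 n₀)))

    M≤C₁ : ∀ n → n₀ ℕ.≤ n → M n ≤ C₁
    M≤C₁ n h = ℚ.≤-trans (M≤C n h)
      (subst (_≤ C₁) (ℚ.+-identityˡ C) (ℚ.+-monoˡ-≤ C (ℚ.<⇒≤ (ℚ.positive⁻¹ 1ℚ))))

    M-mono : ∀ {n m} → n ℕ.≤′ m → M n ≤ M m
    M-mono (ℕ.≤′-reflexive refl) = ℚ.≤-refl
    M-mono (ℕ.≤′-step {m} p) = ℚ.≤-trans (M-mono p)
      (subst (_≤ M m + t m) (ℚ.+-identityʳ (M m)) (ℚ.+-monoʳ-≤ (M m) (t≥0 m)))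

    module _ {e η r N₂ N₃} (0<e : 0ℚ < e) (e+e≡δ : e + e ≡ δ) (η+η≡e : η + η ≡ e)
             (0<r : 0ℚ < r) (Cr≡1 : C₁ * r ≡ 1ℚ) (n₀≤N₂ : n₀ ℕ.≤ N₂) (small : t N₂ ≤ η)
             (close : ∀ m n → N₃ ℕ.≤ m → N₃ ℕ.≤ n → ∣ s m - s n ∣ ≤ r * e) where

      N : ℕ
      N = suc (N₁ ℕ.+ (N₂ ℕ.+ N₃))

      module _ {k} (h : N ℕ.≤ suc k) where
        j₁ : N₁ ℕ.≤ suc k
        j₁ = ℕ.m≤n⇒m≤1+n (ℕ.m+n≤o⇒m≤o N₁ (ℕ.≤-pred h))
        j₂ : N₂ ℕ.≤ k
        j₂ = ℕ.m+n≤o⇒m≤o N₂ (ℕ.m+n≤o⇒n≤o N₁ (ℕ.≤-pred h))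
        j₃ : N₃ ℕ.≤ suc k
        j₃ = ℕ.m≤n⇒m≤1+n (ℕ.m+n≤o⇒n≤o N₂ (ℕ.m+n≤o⇒n≤o N₁ (ℕ.≤-pred h)))

      M-close : ∀ m n → N₂ ℕ.≤ m → N₂ ℕ.≤ n → M m - M n ≤ e
      M-close m n hm hn = ℚ.≤-trans (ℚ.+-monoʳ-≤ (M m) (ℚ.neg-antimono-≤ (M-mono (ℕ.≤⇒≤′ hn)))) (move (begin
        M m                     ≤⟨ M≤U n₀≤N₂ hm ⟩
        M N₂ + (t N₂ + t N₂)    ≤⟨ ℚ.+-monoʳ-≤ (M N₂) (ℚ.+-mono-≤ small small) ⟩
        M N₂ + (η + η)          ≡⟨ cong (λ z → M N₂ + z) η+η≡e ⟩
        M N₂ + e                ≡⟨ ℚ.+-comm (M N₂) e ⟩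
        e + M N₂                ∎))
        where open ℚ.≤-Reasoning

      ordered : ∀ m n → N ℕ.≤ m → N ℕ.≤ n → n ℕ.≤ m → ∣ expSum (s m) m - expSum (s n) n ∣ ≤ δ
      ordered (suc m) (suc n) hm hn n≤m = begin
        ∣ expSum a (suc m) - expSum b (suc n) ∣
          ≤⟨ ∣-∣-triangle (expSum a (suc m)) (expSum a (suc n)) (expSum b (suc n)) ⟩
        ∣ expSum a (suc m) - expSum a (suc n) ∣ + ∣ expSum a (suc n) - expSum b (suc n) ∣
          ≤⟨ ℚ.+-mono-≤ (tail≤ a≤K (ℕ.≤⇒≤′ n≤m)) (sum-lip a≤K b≤K n) ⟩
        (M (suc m) - M (suc n)) + ∣ a - b ∣ * M n
          ≤⟨ ℚ.+-mono-≤ (M-close (suc m) (suc n) (ℕ.m≤n⇒m≤1+n (j₂ hm)) (ℕ.m≤n⇒m≤1+n (j₂ hn)))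
               (*-mono (M≥0 n) (ℚ.<⇒≤ (*-pos 0<r 0<e)) (close (suc m) (suc n) (j₃ hm) (j₃ hn))
                 (M≤C₁ n (ℕ.≤-trans n₀≤N₂ (j₂ hn)))) ⟩
        e + r * e * C₁
          ≡⟨ cong (λ z → e + z) (trans (ℚ.*-comm (r * e) C₁) (sym (ℚ.*-assoc C₁ r e))) ⟩
        e + C₁ * r * e
          ≡⟨ cong (λ z → e + z * e) Cr≡1 ⟩
        e + 1ℚ * e
          ≡⟨ cong (λ z → e + z) (ℚ.*-identityˡ e) ⟩
        e + e
          ≡⟨ e+e≡δ ⟩
        δ ∎
        where
        open ℚ.≤-Reasoning
        a b : ℚ
        a = s (suc m)
        b = s (suc n)
        a≤K : ∣ a ∣ ≤ K
        a≤K = s≤K (suc m) (j₁ hm)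
        b≤K : ∣ b ∣ ≤ K
        b≤K = s≤K (suc n) (j₁ hn)

      any-order : ∀ m n → N ℕ.≤ m → N ℕ.≤ n → ∣ expSum (s m) m - expSum (s n) n ∣ ≤ δ
      any-order m n hm hn with ℕ.≤-total n m
      ... | inj₁ n≤m = ordered m n hm hn n≤m
      ... | inj₂ m≤n = subst (_≤ δ) (∣-∣-comm (expSum (s n) n) (expSum (s m) m)) (ordered n m hn hm m≤n)

    go₂ : ∀ {e η r} → 0ℚ < e → e + e ≡ δ → η + η ≡ e → 0ℚ < r → C₁ * r ≡ 1ℚ →
          ∃[ n ] (n₀ ℕ.≤ n × t n ≤ η) →
          ∃[ N ] (∀ m n → N ℕ.≤ m → N ℕ.≤ n → ∣ s m - s n ∣ ≤ r * e) → Goal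
    go₂ 0<e e+e≡δ η+η≡e 0<r Cr≡1 (N₂ , n₀≤N₂ , small) (N₃ , close) =
      N 0<e e+e≡δ η+η≡e 0<r Cr≡1 n₀≤N₂ small close ,
      any-order 0<e e+e≡δ η+η≡e 0<r Cr≡1 n₀≤N₂ small close

    go₁ : IsCauchy s → ∃[ e ] (0ℚ < e × e + e ≡ δ × ∃[ η ] (0ℚ < η × η + η ≡ e)) →
          ∃[ r ] (0ℚ < r × C₁ * r ≡ 1ℚ) → Goal
    go₁ c (e , 0<e , e+e≡δ , η , 0<η , η+η≡e) (r , 0<r , Cr≡1) =
      go₂ 0<e e+e≡δ η+η≡e 0<r Cr≡1 (t-small η 0<η) (c (r * e) (*-pos 0<r 0<e))

  exp-cauchy : ∀ {s} → IsCauchy s → IsCauchy (λ n → expSum (s n) n)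
  exp-cauchy {s} c δ 0<δ = go (bounded c)
    where
    go : ∃[ K ] (0ℚ < K × ∃[ N ] ∀ n → N ℕ.≤ n → ∣ s n ∣ ≤ K) →
         ∃[ N ] ∀ m n → N ℕ.≤ m → N ℕ.≤ n → ∣ expSum (s m) m - expSum (s n) n ∣ ≤ δ
    go (K , 0<K , N₁ , s≤K) = go₁ c
        (δ * ½ , half-pos 0<δ , halves δ , δ * ½ * ½ , half-pos (half-pos 0<δ) , halves (δ * ½))
        (reciprocal C₁ 0<C₁)
      where open ExpCauchy {s} {K} {N₁} 0<K s≤K {δ} 0<δ

open ExpLemmas

-- The partial sums are taken at the rational approximations of x, which has
-- the same limit as summing the series at x.
exp : ℝ → ℝ
exp x = mkℝ (λ n → expSum (seq x n) n) (exp-cauchy (cauchy x))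

-- The σ-algebra generated by the sets B i.
data Measurable {X I : Set} (B : I → Pred X 0ℓ) : Pred X 0ℓ → Set₁ where
  generator    : ∀ i → Measurable B (B i)
  complement   : ∀ {S} → Measurable B S → Measurable B (∁ S)
  union        : ∀ {J} → J ↣ ℕ → {S : J → Pred X 0ℓ} → (∀ j → Measurable B (S j)) → Measurable B (⋃ J S)
  intersection : ∀ {J} → J ↣ ℕ → {S : J → Pred X 0ℓ} → (∀ j → Measurable B (S j)) → Measurable B (⋂ J S)

Event : {X I : Set} → (I → Pred X 0ℓ) → Set₁
Event B = ∃ (Measurable B)

infix 4 _∈ᴱ_

_∈ᴱ_ : {X I : Set} {B : I → Pred X 0ℓ} → X → Event B → Set
x ∈ᴱ S = proj₁ S x

⋃ᴱ : {X I : Set} {B : I → Pred X 0ℓ} → (ℕ → Event B) → Event B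
⋃ᴱ S = ⋃ ℕ (proj₁ ∘ S) , union (↣-id ℕ) (proj₂ ∘ S)

record ProbabilityMeasure {X I : Set} (B : I → Pred X 0ℓ) : Set₁ where
  field
    Pr : Event B → ℝ

    -- The double negation makes equality of events classical: for instance the
    -- union of S and its complement is identified with the whole space.
    Pr-cong : ∀ S S′ → (∀ x → ¬ ¬ (x ∈ᴱ S ⇔ x ∈ᴱ S′)) → Pr S ≃ℝ Pr S′

    Pr-nonneg : ∀ S → 0ℝ ≤ℝ Pr S

    Pr-total : ∀ S → (∀ x → x ∈ᴱ S) → Pr S ≃ℝ 1ℝ

    Pr-countablyAdditive : ∀ (S : ℕ → Event B) →
      (∀ i j → i ≢ j → ∀ x → x ∈ᴱ S i → ¬ (x ∈ᴱ S j)) →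
      (λ n → ∑ℝ n (Pr ∘ S)) ConvergesTo Pr (⋃ᴱ S)

open ProbabilityMeasure public using (Pr)

Node : Set
Node = ℕ

-- An unordered pair of distinct nodes.
record Edge : Set where
  constructor edge
  field
    lo hi  : Node
    .lo<hi : lo ℕ.< hi

open Edge public

record IsGraph (V : List Node) (E : List Edge) : Set where
  field
    nodes-unique : Unique V
    edges-unique : Unique E
    endpoints    : ∀ {e} → e ∈ E → lo e ∈ V × hi e ∈ V

record Graph : Set where
  constructor mkGraph
  field
    nodes   : List Node
    edges   : List Edge
    isGraph : IsGraph nodes edges

open Graph public

Joins : Node → Node → Edge → Set
Joins u v e = (lo e ≡ u × hi e ≡ v) ⊎ (lo e ≡ v × hi e ≡ u)

Adjacent : Graph → Node → Node → Set
Adjacent G u v = Any (Joins u v) (edges G)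

adjacent? : ∀ G u v → Dec (Adjacent G u v)
adjacent? G u v = any? (λ e →
  ((lo e ℕ.≟ u) ×-dec (hi e ℕ.≟ v)) ⊎-dec ((lo e ℕ.≟ v) ×-dec (hi e ℕ.≟ u))) (edges G)

neighbours : Graph → Node → List Node
neighbours G v = filter (adjacent? G v) (nodes G)

degree : Graph → Node → ℕ
degree G v = length (neighbours G v)

-- Ordering the corners makes each triangle occur exactly once.
IsTriangle : Graph → Node × Node × Node → Set
IsTriangle G (u , v , w) = u ℕ.< v × v ℕ.< w × Adjacent G u v × Adjacent G v w × Adjacent G u w

isTriangle? : ∀ G uvw → Dec (IsTriangle G uvw)
isTriangle? G (u , v , w) =
  (u ℕ.<? v) ×-dec (v ℕ.<? w) ×-dec adjacent? G u v ×-dec adjacent? G v w ×-dec adjacent? G u w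

triangles : Graph → List (Node × Node × Node)
triangles G = filter (isTriangle? G) (cartesianProduct (nodes G) (cartesianProduct (nodes G) (nodes G)))

combinations : {A : Set} → ℕ → List A → List (List A)
combinations zero    xs       = [] ∷ []
combinations (suc k) []       = []
combinations (suc k) (x ∷ xs) = map (x ∷_) (combinations k xs) ++ combinations (suc k) xs

stars : ℕ → Graph → List (Node × List Node)
stars k G = concatMap (λ v → map (v ,_) (combinations k (neighbours G v))) (nodes G)

record Statistic : Set₁ where
  field
    Index     : Set
    countable : Index ↣ ℕ
    value     : Graph → Index → ℕ

open Statistic public

scalar : (Graph → ℕ) → Statistic
scalar f = record
  { Index     = ⊤
  ; countable = mk↣ {to = λ _ → 0} (λ _ → refl)
  ; value     = λ G _ → f G
  }

highDegreeNodes : ℕ → Statistic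
highDegreeNodes τ = scalar λ G → length (filter (λ v → τ ℕ.≤? degree G v) (nodes G))

degreeHistogram : Statistic
degreeHistogram = record
  { Index     = ℕ
  ; countable = ↣-id ℕ
  ; value     = λ G i → length (filter (λ v → degree G v ℕ.≟ i) (nodes G))
  }

edgeCount : Statistic
edgeCount = scalar λ G → length (edges G)

triangleCount : Statistic
triangleCount = scalar λ G → length (triangles G)

starCount : ℕ → Statistic
starCount k = scalar λ G → length (stars k G)

accumulate : {A : Set} {T : ℕ} → List A → (Fin T → List A) → Fin T → List A
accumulate init ∂ Fin.zero    = init ++ ∂ Fin.zero
accumulate init ∂ (Fin.suc t) = accumulate (init ++ ∂ Fin.zero) (∂ ∘ Fin.suc) t

-- Since the lists of G_t are duplicate-free, only new nodes and edges are
-- inserted. The index t : Fin T stands for the time step t + 1.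
record GraphSequence (T : ℕ) : Set where
  field
    initial : Graph
    ∂V      : Fin T → List Node
    ∂E      : Fin T → List Edge
    valid   : ∀ t → IsGraph (accumulate (nodes initial) ∂V t) (accumulate (edges initial) ∂E t)

  graphAt : Fin T → Graph
  graphAt t = mkGraph _ _ (valid t)

open GraphSequence public

infix 4 _≋_

_≋_ : {A : Set} → List A → List A → Set
xs ≋ ys = xs ∼[ set ] ys

record OneMoreEdge {T} (𝒢 𝒢′ : GraphSequence T) : Set where
  field
    same-nodes₀ : nodes (initial 𝒢) ≋ nodes (initial 𝒢′)
    same-edges₀ : edges (initial 𝒢) ≋ edges (initial 𝒢′)
    same-∂V     : ∀ t → ∂V 𝒢 t ≋ ∂V 𝒢′ t
    e*          : Edge
    t*          : Fin T
    same-∂E     : ∀ t → t ≢ t* → ∂E 𝒢 t ≋ ∂E 𝒢′ t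
    subset      : ∂E 𝒢′ t* ⊆ ∂E 𝒢 t*
    difference  : ∀ e → (e ∈ ∂E 𝒢 t* × e ∉ ∂E 𝒢′ t*) ⇔ e ≡ e*

EdgeAdjacent : ∀ {T} → GraphSequence T → GraphSequence T → Set
EdgeAdjacent 𝒢 𝒢′ = OneMoreEdge 𝒢 𝒢′ ⊎ OneMoreEdge 𝒢′ 𝒢

record SameUntil {T} (t : ℕ) (𝒢 𝒢′ : GraphSequence T) : Set where
  field
    same-nodes₀ : nodes (initial 𝒢) ≋ nodes (initial 𝒢′)
    same-edges₀ : edges (initial 𝒢) ≋ edges (initial 𝒢′)
    same-∂V     : ∀ s → toℕ s ℕ.< t → ∂V 𝒢 s ≋ ∂V 𝒢′ s
    same-∂E     : ∀ s → toℕ s ℕ.< t → ∂E 𝒢 s ≋ ∂E 𝒢′ s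

Output : ℕ → Statistic → Set
Output T Q = Fin T → Index Q → ℝ

-- The Borel sets of output sequences are generated by requiring one
-- coordinate to lie in a closed interval, given by its centre and radius.
within : ∀ {T Q} → Fin T × Index Q × ℝ × ℝ → Pred (Output T Q) 0ℓ
within (t , i , a , r) o = ∣ o t i -ℝ a ∣ℝ ≤ℝ r

OutputEvent : ℕ → Statistic → Set₁
OutputEvent T Q = Event (within {T} {Q})

DependsOnFirst : ∀ {T Q} → ℕ → OutputEvent T Q → Set
DependsOnFirst t S = ∀ o o′ → (∀ s → toℕ s ℕ.< t → ∀ i → o s i ≃ℝ o′ s i) → o ∈ᴱ S → o′ ∈ᴱ S

record Algorithm (T : ℕ) (Q : Statistic) : Set₁ where
  field
    law : GraphSequence T → ProbabilityMeasure (within {T} {Q})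

    -- The first t outputs are determined by the input up to time t. For t = T
    -- this also says that the lists in the input are treated as sets.
    online : ∀ t 𝒢 𝒢′ → SameUntil t 𝒢 𝒢′ → ∀ S → DependsOnFirst {T} {Q} t S →
             Pr (law 𝒢) S ≃ℝ Pr (law 𝒢′) S

open Algorithm public

EdgeDifferentiallyPrivate : ∀ {T Q} → ℝ → Algorithm T Q → Set₁
EdgeDifferentiallyPrivate ε 𝒜 = ∀ 𝒢 𝒢′ → EdgeAdjacent 𝒢 𝒢′ → ∀ S →
  Pr (law 𝒜 𝒢) S ≤ℝ exp ε *ℝ Pr (law 𝒜 𝒢′) S

-- At all time steps, all components are estimated up to additive error α.
errorAtMost : ∀ {T} Q → ℝ → GraphSequence T → OutputEvent T Q
errorAtMost {T} Q α 𝒢 = _ , intersection (mk↣ {to = toℕ} toℕ-injective) λ t →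
  intersection (countable Q) λ i →
    generator {B = within {T} {Q}} (t , i , ℕ→ℝ (value Q (graphAt 𝒢 t) i) , α)

Accurate : ∀ {T Q} → ℝ → ℝ → Algorithm T Q → Set
Accurate {T} {Q} α β 𝒜 = ∀ 𝒢 → β ≤ℝ Pr (law 𝒜 𝒢) (errorAtMost Q α 𝒢)

-- Every ε-edge-differentially private algorithm that, with probability at
-- least β on every input, has error at most α satisfies α ≥ b.
PrivateErrorAtLeast : ℝ → ℝ → ℕ → Statistic → ℝ → Set₁
PrivateErrorAtLeast ε β T Q b = ∀ (𝒜 : Algorithm T Q) → EdgeDifferentiallyPrivate ε 𝒜 →
  ∀ α → Accurate α β 𝒜 → b ≤ℝ α

{-# OPTIONS --safe #-}

-- Packing argument. Insert one batch of L edges, at a time step j of our choice,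
-- into a fixed graph, so that the statistic changes by at least L at time j. If
-- the error were less than L/2, the events "accurate for the batch at time j" would
-- be pairwise disjoint for the T possible values of j. Each has probability at
-- least β when the batch is inserted at time j, hence, removing the L edges one at
-- a time, probability at least β / (exp ε)^L when nothing is inserted. These T
-- probabilities sum to at most 1, so β T ≤ (exp ε)^L, which fails for some L of
-- order log T.
module Submission where

open import Defs
open import Data.Empty using (⊥; ⊥-elim)
open import Data.Fin as Fin using (Fin; toℕ; fromℕ<)
import Data.Fin.Properties as Fin
open import Data.List using (List; []; _∷_; _++_; length; map; concatMap; filter; upTo; applyUpTo; allFin;
  cartesianProductWith; cartesianProduct)
open import Data.List.Membership.Propositional using (_∈_; _∉_; lose; find)
open import Data.List.Membership.Propositional.Properties
open import Data.List.Properties using (++-identityʳ; length-++; length-map; length-applyUpTo; filter-none)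
open import Data.List.Relation.Binary.Subset.Propositional using (_⊆_)
open import Data.List.Relation.Unary.All as All using ([]; _∷_)
open import Data.List.Relation.Unary.AllPairs using ([]; _∷_)
open import Data.List.Relation.Unary.Any as Any using (Any; here; there)
import Data.List.Relation.Unary.Any.Properties as Any
open import Data.List.Relation.Unary.Unique.Propositional using (Unique)
import Data.List.Relation.Unary.Unique.Propositional.Properties as Unique
open import Data.Nat as ℕ using (ℕ; zero; suc; _≤_; z≤n; s≤s)
open import Data.Nat.DivMod using (m≡m%n+[m/n]*n; m/n*n≤m; m%n<n)
open import Data.Nat.Induction using (<-rec)
open import Data.Nat.Logarithm using (⌊log₂_⌋; ⌊log₂⌋-mono-≤; ⌊log₂[2^n]⌋≡n; ⌊log₂⌊n/2⌋⌋≡⌊log₂n⌋∸1)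
import Data.Nat.Properties as ℕ
import Data.Nat.Solver as ℕ-Solver
open import Data.Product using (∃-syntax; _×_; _,_; proj₁; proj₂)
open import Data.Rational as ℚ using (ℚ; 0ℚ; 1ℚ; ½; ∣_∣; _+_; _-_; _*_; -_; _<_) renaming (_≤_ to _≤ℚ_)
import Data.Rational.Properties as ℚ
open import Data.Rational.Solver using (module +-*-Solver)
open import Data.Sum using (_⊎_; inj₁; inj₂; swap)
open import Data.Unit using (tt)
open import Function using (_∘_; id)
open import Function.Bundles using (_↣_; mk↣; mk⇔)
open import Level using (0ℓ)
open import Relation.Binary using (tri<; tri≈; tri>)
open import Relation.Binary.PropositionalEquality
open import Relation.Nullary using (¬_; Dec; yes; no)
open import Relation.Unary using (Pred)

open RationalLemmas using (inv; inv-pos; half-pos; ≤∣∣; *-monoʳ; *-pos; ∣-∣-comm; 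
  ℕ→ℚ-suc; ℕ→ℚ-inv; ℕ→ℚ-mono; ℕ→ℚ-nonneg; reciprocal; archimedean; archimedean′)
open ProductLemmas using (bounded)

-- The hubs belong to the initial graph, so they cost no privacy, and they let every spoke act on
-- its own: a star of L edges among isolated nodes closes no triangle and raises at most one degree
-- above 1. Reals are Cauchy sequences without decidable order, so β is replaced by a rational `p`
-- below it and exp ε by a power 2^k bounding its approximations; probabilities get rational lower
-- bounds, divided by 2^k once per removed edge. With 1 ≤ p 2^b a contradiction needs kL + b < log₂
-- T, which allows L of order (log₂ T)/k. Hence the constant 1/(4k) depends on ε alone, while β
-- affects, through b, only how large T has to be.

-- Linear inequalities are proved by adding up hypotheses and leaving the equality
-- of the two slacks to the ring solver.
linear : ∀ {a b c d} → c ≤ℚ d → d - c ≡ b - a → a ≤ℚ b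
linear {a} {b} {c} {d} c≤d eq = subst₂ _≤ℚ_
  (solve 2 (λ a c → c :+ (a :- c) := a) refl a c)
  (begin
    d + (a - c)   ≡⟨ solve 3 (λ a c d → d :+ (a :- c) := d :- c :+ a) refl a c d ⟩
    d - c + a     ≡⟨ cong (λ z → z + a) eq ⟩
    b - a + a     ≡⟨ solve 2 (λ a b → b :- a :+ a := b) refl a b ⟩
    b             ∎)
  (ℚ.+-monoˡ-≤ (a - c) c≤d)
  where
  open ≡-Reasoning
  open +-*-Solver

<⇒≱ : ∀ {p q} → p < q → ¬ (q ≤ℚ p)
<⇒≱ p<q q≤p = ℚ.<-irrefl refl (ℚ.<-≤-trans p<q q≤p)

ℕ→ℚ-+ : ∀ m n → ℕ→ℚ (m ℕ.+ n) ≡ ℕ→ℚ m + ℕ→ℚ n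
ℕ→ℚ-+ zero    n = sym (ℚ.+-identityˡ (ℕ→ℚ n))
ℕ→ℚ-+ (suc m) n = begin
  ℕ→ℚ (suc (m ℕ.+ n))     ≡⟨ ℕ→ℚ-suc (m ℕ.+ n) ⟩
  1ℚ + ℕ→ℚ (m ℕ.+ n)      ≡⟨ cong (λ z → 1ℚ + z) (ℕ→ℚ-+ m n) ⟩
  1ℚ + (ℕ→ℚ m + ℕ→ℚ n)    ≡⟨ ℚ.+-assoc 1ℚ (ℕ→ℚ m) (ℕ→ℚ n) ⟨
  1ℚ + ℕ→ℚ m + ℕ→ℚ n      ≡⟨ cong (λ z → z + ℕ→ℚ n) (ℕ→ℚ-suc m) ⟨
  ℕ→ℚ (suc m) + ℕ→ℚ n     ∎
  where open ≡-Reasoning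

ℕ→ℚ-* : ∀ m n → ℕ→ℚ (m ℕ.* n) ≡ ℕ→ℚ m * ℕ→ℚ n
ℕ→ℚ-* zero    n = sym (ℚ.*-zeroˡ (ℕ→ℚ n))
ℕ→ℚ-* (suc m) n = begin
  ℕ→ℚ (n ℕ.+ m ℕ.* n)          ≡⟨ ℕ→ℚ-+ n (m ℕ.* n) ⟩
  ℕ→ℚ n + ℕ→ℚ (m ℕ.* n)        ≡⟨ cong (λ z → ℕ→ℚ n + z) (ℕ→ℚ-* m n) ⟩
  ℕ→ℚ n + ℕ→ℚ m * ℕ→ℚ n        ≡⟨ solve 2 (λ m n → n :+ m :* n := (con 1ℚ :+ m) :* n) refl (ℕ→ℚ m) (ℕ→ℚ n) ⟩
  (1ℚ + ℕ→ℚ m) * ℕ→ℚ n         ≡⟨ cong (_* ℕ→ℚ n) (ℕ→ℚ-suc m) ⟨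
  ℕ→ℚ (suc m) * ℕ→ℚ n          ∎
  where
  open ≡-Reasoning
  open +-*-Solver

ℕ→ℚ-mono-< : ∀ {m n} → m ℕ.< n → ℕ→ℚ m < ℕ→ℚ n
ℕ→ℚ-mono-< {m} {n} m<n = ℚ.<-≤-trans
  (subst₂ _<_ (ℚ.+-identityˡ (ℕ→ℚ m)) (sym (ℕ→ℚ-suc m)) (ℚ.+-monoˡ-< (ℕ→ℚ m) (ℚ.positive⁻¹ 1ℚ)))
  (ℕ→ℚ-mono m<n)

≤-closure : ∀ {p q} → (∀ δ → 0ℚ < δ → p ≤ℚ q + δ) → p ≤ℚ q
≤-closure {p} {q} h = ℚ.≮⇒≥ λ q<p →
  let 0<p-q = half-pos (subst (_< p - q) (ℚ.+-inverseʳ q) (ℚ.+-monoˡ-< (- q) q<p))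
  in <⇒≱ 0<p-q (linear (h _ 0<p-q)
       (solve 2 (λ p q → q :+ (p :- q) :* con ½ :- p := con 0ℚ :- (p :- q) :* con ½) refl p q))
  where open +-*-Solver

-- Order on the reals through rational approximations

Eventually : (ℕ → Set) → Set
Eventually P = ∃[ N ] ∀ n → N ≤ n → P n

infixr 6 _⊓_

_⊓_ : ∀ {P Q} → Eventually P → Eventually Q → Eventually (λ n → P n × Q n)
(N₁ , h₁) ⊓ (N₂ , h₂) = N₁ ℕ.⊔ N₂ , λ n N≤n →
  h₁ n (ℕ.≤-trans (ℕ.m≤m⊔n N₁ N₂) N≤n) , h₂ n (ℕ.≤-trans (ℕ.m≤n⊔m N₁ N₂) N≤n)

eventually : ∀ {P Q : ℕ → Set} → (∀ n → P n → Q n) → Eventually P → Eventually Q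
eventually f (N , h) = N , λ n N≤n → f n (h n N≤n)

satisfied : ∀ {P} → Eventually P → ∃[ n ] P n
satisfied (N , h) = N , h N ℕ.≤-refl

≤ℝ-trans : ∀ x y z → x ≤ℝ y → y ≤ℝ z → x ≤ℝ z
≤ℝ-trans x y z x≤y y≤z δ 0<δ =
  eventually (λ n (h₁ , h₂) → linear (ℚ.+-mono-≤ h₁ h₂) (solve 4 (λ x y z δ →
      (y :+ δ :* con ½ :+ (z :+ δ :* con ½)) :- (x :+ y) := z :+ δ :- x) refl (seq x n) (seq y n) (seq z n) δ))
    (x≤y (δ * ½) (half-pos 0<δ) ⊓ y≤z (δ * ½) (half-pos 0<δ))
  where open +-*-Solver

+ℝ-lower : ∀ p q x y → ℚ→ℝ p ≤ℝ x → ℚ→ℝ q ≤ℝ y → ℚ→ℝ (p + q) ≤ℝ x +ℝ y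
+ℝ-lower p q x y p≤x q≤y δ 0<δ =
  eventually (λ n (h₁ , h₂) → linear (ℚ.+-mono-≤ h₁ h₂) (solve 5 (λ p q x y δ →
      (x :+ δ :* con ½ :+ (y :+ δ :* con ½)) :- (p :+ q) := x :+ y :+ δ :- (p :+ q)) refl p q (seq x n) (seq y n) δ))
    (p≤x (δ * ½) (half-pos 0<δ) ⊓ q≤y (δ * ½) (half-pos 0<δ))
  where open +-*-Solver

<ℝ⇒rational-lower : ∀ {x} → 0ℝ <ℝ x → ∃[ q ] (0ℚ < q × ℚ→ℝ q ≤ℝ x)
<ℝ⇒rational-lower {x} (q , 0<q , h) = q , 0<q , λ δ 0<δ →
  eventually (λ n q≤x → linear (ℚ.+-mono-≤ q≤x (ℚ.<⇒≤ 0<δ)) (solve 3 (λ q x δ →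
    x :+ δ :- (con 0ℚ :+ q :+ con 0ℚ) := x :+ δ :- q) refl q (seq x n) δ)) h
  where open +-*-Solver

-- Comparing one pair of sufficiently good approximations decides between
-- x ≤ y + δ and y < x, so the contrapositive is constructive.
≮ℝ⇒≥ℝ : ∀ x y → ¬ (y <ℝ x) → x ≤ℝ y
≮ℝ⇒≥ℝ x y y≮x δ 0<δ = go (cauchy x e 0<e) (cauchy y e 0<e)
  where
  open +-*-Solver
  -- Beyond N each sequence moves by at most e. Comparing with margin δ/2 + 2e, success gives x ≤ y
  -- + δ/2 + 4e, which is y + δ because 4e = δ/2, and failure leaves a gap of δ/2.
  e : ℚ
  e = δ * ½ * ½ * ½
  0<e : 0ℚ < e
  0<e = half-pos (half-pos (half-pos 0<δ))
  go : ∃[ N ] (∀ m n → N ≤ m → N ≤ n → ∣ seq x m - seq x n ∣ ≤ℚ e) →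
       ∃[ N ] (∀ m n → N ≤ m → N ≤ n → ∣ seq y m - seq y n ∣ ≤ℚ e) →
       Eventually (λ n → seq x n ≤ℚ seq y n + δ)
  go (N₁ , hx) (N₂ , hy) with ℚ._≤?_ (seq x (N₁ ℕ.⊔ N₂)) (seq y (N₁ ℕ.⊔ N₂) + (δ * ½ + (e + e)))
  ... | yes x≤y = N , λ n N≤n →
      linear (ℚ.+-mono-≤ x≤y (ℚ.+-mono-≤
          (ℚ.≤-trans (≤∣∣ _) (hx n N (ℕ.≤-trans (ℕ.m≤m⊔n N₁ N₂) N≤n) (ℕ.m≤m⊔n N₁ N₂)))
          (ℚ.≤-trans (≤∣∣ _) (hy N n (ℕ.m≤n⊔m N₁ N₂) (ℕ.≤-trans (ℕ.m≤n⊔m N₁ N₂) N≤n)))))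
        (solve 5 (λ xN yN xn yn δ →
          yN :+ (δ :* con ½ :+ (ε δ :+ ε δ)) :+ (ε δ :+ ε δ) :- (xN :+ ((xn :- xN) :+ (yN :- yn))) := yn :+ δ :- xn)
          refl (seq x N) (seq y N) (seq x n) (seq y n) δ)
    where
    N : ℕ
    N = N₁ ℕ.⊔ N₂
    ε = λ (δ : Polynomial 5) → δ :* con ½ :* con ½ :* con ½
  ... | no x≰y = ⊥-elim (y≮x (δ * ½ , half-pos 0<δ , N , λ n N≤n →
      linear (ℚ.+-mono-≤ (ℚ.<⇒≤ (ℚ.≰⇒> x≰y)) (ℚ.+-mono-≤
          (ℚ.≤-trans (≤∣∣ _) (hx N n (ℕ.m≤m⊔n N₁ N₂) (ℕ.≤-trans (ℕ.m≤m⊔n N₁ N₂) N≤n)))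
          (ℚ.≤-trans (≤∣∣ _) (hy n N (ℕ.≤-trans (ℕ.m≤n⊔m N₁ N₂) N≤n) (ℕ.m≤n⊔m N₁ N₂)))))
        (solve 5 (λ xN yN xn yn δ →
          xN :+ (ε δ :+ ε δ) :- (yN :+ (δ :* con ½ :+ (ε δ :+ ε δ)) :+ ((xN :- xn) :+ (yn :- yN)))
            := xn :- (yn :+ δ :* con ½))
          refl (seq x N) (seq y N) (seq x n) (seq y n) δ)))
    where
    N : ℕ
    N = N₁ ℕ.⊔ N₂
    ε = λ (δ : Polynomial 5) → δ :* con ½ :* con ½ :* con ½

-- Approximations `p` of a nonnegative real may be slightly negative, so `e` cannot simply be
-- replaced by `K`. Shifting by η repairs this: e p = e (p + η) - e η is at most K (p + η) + K η.
*-upper : ∀ {e K p η} → ∣ e ∣ ≤ℚ K → 0ℚ ≤ℚ p + η → 0ℚ ≤ℚ η → e * p ≤ℚ K * p + (K * η + K * η)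
*-upper {e} {K} {p} {η} ∣e∣≤K 0≤p+η 0≤η =
  linear (ℚ.+-mono-≤ (*-monoʳ (p + η) 0≤p+η (ℚ.≤-trans (≤∣∣ e) ∣e∣≤K))
                     (*-monoʳ η 0≤η (ℚ.≤-trans (≤∣∣ (- e)) (subst (_≤ℚ K) (sym (ℚ.∣-p∣≡∣p∣ e)) ∣e∣≤K))))
    (solve 4 (λ e K p η → (K :* (p :+ η) :+ K :* η) :- (e :* (p :+ η) :+ (:- e) :* η)
        := (K :* p :+ (K :* η :+ K :* η)) :- e :* p) refl e K p η)
  where open +-*-Solver

-- One step of group privacy: the factor `e` is exchanged for its rational bound `K`, which cancels
-- without dividing by a real.
*ℝ-cancel-lower : ∀ {K} x y e q → 0ℚ < K → Eventually (λ n → ∣ seq e n ∣ ≤ℚ K) → 0ℝ ≤ℝ y →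
                  x ≤ℝ e *ℝ y → ℚ→ℝ (K * q) ≤ℝ x → ℚ→ℝ q ≤ℝ y
*ℝ-cancel-lower {K} x y e q 0<K e≤K 0≤y x≤ey Kq≤x δ 0<δ =
  eventually (λ n (e≤K , 0≤y , x≤ey , Kq≤x) → ℚ.*-cancelˡ-≤-pos K {{ℚ.positive 0<K}}
      (linear (ℚ.+-mono-≤ Kq≤x (ℚ.+-mono-≤ x≤ey (*-upper {p = seq y n} e≤K 0≤y (ℚ.<⇒≤ 0<η))))
        (solve 6 (λ K q x y z δ →
          x :+ K :* (δ :* con ½ :* con ½) :+ (z :+ K :* (δ :* con ½ :* con ½) :+
            (K :* y :+ (K :* (δ :* con ½ :* con ½) :+ K :* (δ :* con ½ :* con ½)))) :- (K :* q :+ (x :+ z))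
            := K :* (y :+ δ) :- K :* q) refl K q (seq x n) (seq y n) (seq e n * seq y n) δ)))
    (e≤K ⊓ 0≤y η 0<η ⊓ x≤ey (K * η) (*-pos 0<K 0<η) ⊓ Kq≤x (K * η) (*-pos 0<K 0<η))
  where
  open +-*-Solver
  -- Four errors K η add up, two from the real inequalities involving `x` and two from `*-upper`;
  -- together they make K δ.
  η : ℚ
  η = δ * ½ * ½
  0<η : 0ℚ < η
  0<η = half-pos (half-pos 0<δ)

-- All hypotheses hold eventually, so one common index suffices: there b - a ≤ |o - a| + |o - b| ≤
-- 2α + δ, which is less than 2 (α + δ) ≤ 2x.
∣∣-sum-lower : ∀ o a b α {δ x} → 0ℚ < δ → Eventually (λ n → seq α n + δ ≤ℚ x) → x + x ≤ℚ b - a →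
               ∣ o -ℝ ℚ→ℝ a ∣ℝ ≤ℝ α → ¬ (∣ o -ℝ ℚ→ℝ b ∣ℝ ≤ℝ α)
∣∣-sum-lower o a b α {δ} {x} 0<δ α<x gap near-a near-b
  with satisfied (α<x ⊓ near-a (δ * ½) (half-pos 0<δ) ⊓ near-b (δ * ½) (half-pos 0<δ))
... | n , α+δ≤x , oa , ob = <⇒≱ 0<δ
  (linear (ℚ.+-mono-≤ gap (ℚ.+-mono-≤ (ℚ.+-mono-≤ α+δ≤x α+δ≤x) (ℚ.+-mono-≤ (ℚ.≤-trans (≤∣∣ _) oa)
      (ℚ.≤-trans (≤∣∣ _) (subst (_≤ℚ seq α n + δ * ½) (∣-∣-comm (seq o n) b) ob)))))
    (solve 6 (λ o a b α δ x → b :- a :+ (x :+ x :+ (α :+ δ :* con ½ :+ (α :+ δ :* con ½))) :-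
        (x :+ x :+ (α :+ δ :+ (α :+ δ) :+ ((o :- a) :+ (b :- o)))) := con 0ℚ :- δ) refl (seq o n) a b (seq α n) δ x))
  where open +-*-Solver

upper-through-limit : ∀ {t δ} {s u : ℕ → ℚ} → let η = δ * ½ * ½ in
  ∃[ n ] (t ≤ℚ s n + η × ∣ s n - u n ∣ ≤ℚ η + η × u n ≤ℚ 1ℚ + η) → t ≤ℚ 1ℚ + δ
upper-through-limit {t} {δ} {s} {u} (n , t≤s , s-u , u≤1) =
  linear (ℚ.+-mono-≤ t≤s (ℚ.+-mono-≤ (ℚ.≤-trans (≤∣∣ _) s-u) u≤1))
    (solve 4 (λ t s u δ → s :+ δ :* con ½ :* con ½ :+ (δ :* con ½ :* con ½ :+ δ :* con ½ :* con ½
        :+ (con 1ℚ :+ δ :* con ½ :* con ½)) :- (t :+ (s :- u :+ u)) := con 1ℚ :+ δ :- t)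
      refl t (s n) (u n) δ)
  where open +-*-Solver

-- Disjoint events

⊥↣ℕ : ⊥ ↣ ℕ
⊥↣ℕ = mk↣ {to = ⊥-elim} λ {}

fullᴱ : {X I : Set} {B : I → Pred X 0ℓ} → Event B
fullᴱ = _ , intersection ⊥↣ℕ {S = ⊥-elim} λ ()

emptyᴱ : {X I : Set} {B : I → Pred X 0ℓ} → Event B
emptyᴱ = _ , union ⊥↣ℕ {S = ⊥-elim} λ ()

module _ {X I : Set} {B : I → Pred X 0ℓ} (μ : ProbabilityMeasure B) where
  open ProbabilityMeasure μ hiding (Pr)

  -- Adding the complement of the union as term 0 makes the family exhaust the space, so that the
  -- bound 1 on the sum comes from `Pr-total` and additivity alone.
  withRemainder : (ℕ → Event B) → ℕ → Event B
  withRemainder S zero    = _ , complement (proj₂ (⋃ᴱ S))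
  withRemainder S (suc n) = S n

  withRemainder-disjoint : ∀ S → (∀ i j → i ≢ j → ∀ x → x ∈ᴱ S i → ¬ (x ∈ᴱ S j)) →
    ∀ i j → i ≢ j → ∀ x → x ∈ᴱ withRemainder S i → ¬ (x ∈ᴱ withRemainder S j)
  withRemainder-disjoint S dis zero    zero    i≢j = ⊥-elim (i≢j refl)
  withRemainder-disjoint S dis zero    (suc j) i≢j x x∉ x∈Sj = x∉ (j , x∈Sj)
  withRemainder-disjoint S dis (suc i) zero    i≢j x x∈Si x∉ = x∉ (i , x∈Si)
  withRemainder-disjoint S dis (suc i) (suc j) i≢j = dis i j (i≢j ∘ cong suc)

  -- Membership in the union is not decidable in general, so only the double negation is available;
  -- `Pr-cong` identifies events up to exactly this.
  withRemainder-exhausts : ∀ S x → ¬ ¬ (x ∈ᴱ ⋃ᴱ (withRemainder S))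
  withRemainder-exhausts S x x∉ = x∉ (zero , λ (i , x∈Si) → x∉ (suc i , x∈Si))

  Pr-exhaustive : ∀ S → (∀ x → ¬ ¬ (x ∈ᴱ S)) → Pr μ S ≤ℝ 1ℝ
  Pr-exhaustive S all = ≤ℝ-trans (Pr μ S) (Pr μ fullᴱ) 1ℝ
    (proj₁ (Pr-cong S fullᴱ λ x ¬same → all x λ x∈S → ¬same (mk⇔ (λ _ ()) (λ _ → x∈S))))
    (proj₁ (Pr-total fullᴱ λ _ ()))

  -- Additivity controls only partial sums beyond an unknown index. As the terms are nonnegative,
  -- the bound T q reached after the first T events persists in all later partial sums and passes to
  -- the limit, which is at most 1.
  packing : ∀ (S : ℕ → Event B) → (∀ i j → i ≢ j → ∀ x → x ∈ᴱ S i → ¬ (x ∈ᴱ S j)) →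
            ∀ T q → (∀ j → j ℕ.< T → ℚ→ℝ q ≤ℝ Pr μ (S j)) → ℕ→ℚ T * q ≤ℚ 1ℚ
  packing S dis T q lower = ≤-closure bound
    where
    open +-*-Solver
    C : ℕ → Event B
    C = withRemainder S

    first : ∀ n → n ≤ T → ℚ→ℝ (ℕ→ℚ n * q) ≤ℝ ∑ℝ (suc n) (Pr μ ∘ C)
    first zero _ = subst (λ z → ℚ→ℝ z ≤ℝ ∑ℝ 1 (Pr μ ∘ C)) (sym (ℚ.*-zeroˡ q))
      (+ℝ-lower 0ℚ 0ℚ 0ℝ (Pr μ (C 0)) (λ δ 0<δ → 0 , λ _ _ → ℚ.<⇒≤ (subst (0ℚ <_) (sym (ℚ.+-identityˡ δ)) 0<δ))
        (Pr-nonneg (C 0)))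
    first (suc n) n<T = subst (λ z → ℚ→ℝ z ≤ℝ ∑ℝ (suc (suc n)) (Pr μ ∘ C))
      (trans (solve 2 (λ n q → n :* q :+ q := (con 1ℚ :+ n) :* q) refl (ℕ→ℚ n) q) (cong (_* q) (sym (ℕ→ℚ-suc n))))
      (+ℝ-lower (ℕ→ℚ n * q) q (∑ℝ (suc n) (Pr μ ∘ C)) (Pr μ (S n)) (first n (ℕ.<⇒≤ n<T)) (lower n n<T))

    more : ∀ k → ℚ→ℝ (ℕ→ℚ T * q) ≤ℝ ∑ℝ (k ℕ.+ suc T) (Pr μ ∘ C)
    more zero    = first T ℕ.≤-refl
    more (suc k) = subst (λ z → ℚ→ℝ z ≤ℝ ∑ℝ (suc k ℕ.+ suc T) (Pr μ ∘ C)) (ℚ.+-identityʳ (ℕ→ℚ T * q))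
      (+ℝ-lower (ℕ→ℚ T * q) 0ℚ (∑ℝ (k ℕ.+ suc T) (Pr μ ∘ C)) (Pr μ (C (k ℕ.+ suc T))) (more k) (Pr-nonneg (C (k ℕ.+ suc T))))

    bound : ∀ δ → 0ℚ < δ → ℕ→ℚ T * q ≤ℚ 1ℚ + δ
    bound δ 0<δ = through (Pr-countablyAdditive C (withRemainder-disjoint S dis) η 0<η)
      where
      η : ℚ
      η = δ * ½ * ½
      0<η : 0ℚ < η
      0<η = half-pos (half-pos 0<δ)
      through : Eventually (λ m → ∣ ∑ℝ m (Pr μ ∘ C) -ℝ Pr μ (⋃ᴱ C) ∣ℝ ≤ℝ ℚ→ℝ η) → ℕ→ℚ T * q ≤ℚ 1ℚ + δ
      through (N , near) = upper-through-limit {δ = δ} {seq (∑ℝ (N ℕ.+ suc T) (Pr μ ∘ C))} {seq (Pr μ (⋃ᴱ C))}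
        (satisfied (more N η 0<η ⊓ near (N ℕ.+ suc T) (ℕ.m≤m+n N (suc T)) η 0<η
          ⊓ Pr-exhaustive (⋃ᴱ C) (withRemainder-exhausts S) η 0<η))

  -- The finite family is continued by empty events to meet countable additivity. The decision is an
  -- argument so that proofs can split on it directly.
  onFin : ∀ {T} → (Fin T → Event B) → ∀ {n} → Dec (n ℕ.< T) → Event B
  onFin S (yes n<T) = S (fromℕ< n<T)
  onFin S (no _)    = emptyᴱ

  onFin-disjoint : ∀ {T} (S : Fin T → Event B) → (∀ i j → i ≢ j → ∀ x → x ∈ᴱ S i → ¬ (x ∈ᴱ S j)) →
    ∀ {i j} (i<?T : Dec (i ℕ.< T)) (j<?T : Dec (j ℕ.< T)) → i ≢ j →
    ∀ x → x ∈ᴱ onFin S i<?T → ¬ (x ∈ᴱ onFin S j<?T)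
  onFin-disjoint S dis (yes i<T) (yes j<T) i≢j = dis _ _ λ eq → i≢j (Fin.fromℕ<-injective _ _ i<T j<T eq)
  onFin-disjoint S dis (yes _)   (no _)    i≢j x _ (() , _)
  onFin-disjoint S dis (no _)    _         i≢j x (() , _)

  packing-Fin : ∀ {T} (S : Fin T → Event B) → (∀ i j → i ≢ j → ∀ x → x ∈ᴱ S i → ¬ (x ∈ᴱ S j)) →
    ∀ q → (∀ j → ℚ→ℝ q ≤ℝ Pr μ (S j)) → ℕ→ℚ T * q ≤ℚ 1ℚ
  packing-Fin {T} S dis q lower = packing (λ n → onFin S (n ℕ.<? T)) (λ i j → onFin-disjoint S dis (i ℕ.<? T) (j ℕ.<? T))
    T q (λ j j<T → lower′ (j ℕ.<? T) j<T)
    where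
    lower′ : ∀ {n} (n<?T : Dec (n ℕ.< T)) → n ℕ.< T → ℚ→ℝ q ≤ℝ Pr μ (onFin S n<?T)
    lower′ (yes n<T) _   = lower (fromℕ< n<T)
    lower′ (no n≮T)  n<T = ⊥-elim (n≮T n<T)

-- Gadget graphs and their insertion sequences

-- Most counts below are bounded by an inclusion: from below by a duplicate-free list of witnesses,
-- from above by a list covering the counted items.
⊆⇒length-≤ : {A : Set} {xs ys : List A} → Unique xs → xs ⊆ ys → length xs ≤ length ys
⊆⇒length-≤ [] _ = z≤n
⊆⇒length-≤ {xs = x ∷ xs} (x∉xs ∷ uniq) xs⊆ys with ∈-∃++ (xs⊆ys (here refl))
... | ys , zs , refl = begin
  suc (length xs)              ≤⟨ s≤s (⊆⇒length-≤ uniq rest) ⟩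
  suc (length (ys ++ zs))      ≡⟨ cong suc (length-++ ys) ⟩
  suc (length ys ℕ.+ length zs)  ≡⟨ ℕ.+-suc (length ys) (length zs) ⟨
  length ys ℕ.+ suc (length zs)  ≡⟨ length-++ ys ⟨
  length (ys ++ x ∷ zs)        ∎
  where
  open ℕ.≤-Reasoning
  rest : xs ⊆ ys ++ zs
  rest v∈xs with ∈-++⁻ ys (xs⊆ys (there v∈xs))
  ... | inj₁ v∈ys         = ∈-++⁺ˡ v∈ys
  ... | inj₂ (here refl)  = ⊥-elim (All.lookup x∉xs v∈xs refl)
  ... | inj₂ (there v∈zs) = ∈-++⁺ʳ ys v∈zs

≋-reflexive : {A : Set} {xs ys : List A} → xs ≡ ys → xs ≋ ys
≋-reflexive refl = mk⇔ id id

single : {A : Set} {T : ℕ} → Fin T → List A → Fin T → List A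
single Fin.zero    xs Fin.zero    = xs
single Fin.zero    xs (Fin.suc t) = []
single (Fin.suc j) xs Fin.zero    = []
single (Fin.suc j) xs (Fin.suc t) = single j xs t

single-at : ∀ {A T} (j : Fin T) (xs : List A) → single j xs j ≡ xs
single-at Fin.zero    xs = refl
single-at (Fin.suc j) xs = single-at j xs

single-off : ∀ {A T} (j t : Fin T) (xs : List A) → t ≢ j → single j xs t ≡ []
single-off Fin.zero    Fin.zero    xs t≢j = ⊥-elim (t≢j refl)
single-off Fin.zero    (Fin.suc t) xs t≢j = refl
single-off (Fin.suc j) Fin.zero    xs t≢j = refl
single-off (Fin.suc j) (Fin.suc t) xs t≢j = single-off j t xs (t≢j ∘ cong Fin.suc)

single-[] : ∀ {A T} (j t : Fin T) → single j [] t ≡ [] {A = A}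
single-[] Fin.zero    Fin.zero    = refl
single-[] Fin.zero    (Fin.suc t) = refl
single-[] (Fin.suc j) Fin.zero    = refl
single-[] (Fin.suc j) (Fin.suc t) = single-[] j t

accumulate-[] : ∀ {A T} (init : List A) (t : Fin T) → accumulate init (λ _ → []) t ≡ init
accumulate-[] init Fin.zero    = ++-identityʳ init
accumulate-[] init (Fin.suc t) = trans (accumulate-[] (init ++ []) t) (++-identityʳ init)

accumulate-before : ∀ {A T} (init : List A) {xs} {j t : Fin T} → t Fin.< j → accumulate init (single j xs) t ≡ init
accumulate-before init {j = Fin.suc j} {Fin.zero}  t<j       = ++-identityʳ init
accumulate-before init {j = Fin.suc j} {Fin.suc t} (s≤s t<j) =
  trans (accumulate-before (init ++ []) t<j) (++-identityʳ init)

accumulate-from : ∀ {A T} (init : List A) {xs} {j t : Fin T} → j Fin.≤ t → accumulate init (single j xs) t ≡ init ++ xs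
accumulate-from init      {j = Fin.zero}  {Fin.zero}  j≤t       = refl
accumulate-from init {xs} {j = Fin.zero}  {Fin.suc t} j≤t       = accumulate-[] (init ++ xs) t
accumulate-from init {xs} {j = Fin.suc j} {Fin.suc t} (s≤s j≤t) =
  trans (accumulate-from (init ++ []) j≤t) (cong (_++ xs) (++-identityʳ init))

-- The nodes 0 , … , L are followed by m hubs. Initially every hub is joined to
-- every node that is not a hub; the batch consists of the spokes from 0 to
-- 1 , … , L. The spokes raise the degrees of 1 , … , L from m to m + 1, which
-- yields L new nodes of degree ≥ m + 1 and L new (m + 1)-stars; for m = 0 they
-- leave no isolated node except possibly 0, and for m = 1 each closes a triangle.
gadgetNodes : ℕ → ℕ → List Node
gadgetNodes L m = upTo (suc L ℕ.+ m)

hubEdge : ∀ L {m} → Fin (suc L) → Fin m → Edge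
hubEdge L i a = edge (toℕ i) (suc L ℕ.+ toℕ a) (ℕ.≤-trans (Fin.toℕ<n i) (ℕ.m≤m+n (suc L) (toℕ a)))

hubEdges : ℕ → ℕ → List Edge
hubEdges L m = cartesianProductWith (hubEdge L) (allFin (suc L)) (allFin m)

-- Built from the largest tip downwards, so that one more spoke is one fresh edge at the head, the
-- shape of an edge-adjacent pair.
spokes : ℕ → List Edge
spokes zero    = []
spokes (suc l) = edge 0 (suc l) (s≤s z≤n) ∷ spokes l

∈-hubEdges⁻ : ∀ {L m e} → e ∈ hubEdges L m → lo e ≤ L × ∃[ a ] (a ℕ.< m × hi e ≡ suc L ℕ.+ a)
∈-hubEdges⁻ {L} {m} e∈ with ∈-cartesianProductWith⁻ (hubEdge L) (allFin (suc L)) (allFin m) e∈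
... | i , a , _ , _ , refl = ℕ.≤-pred (Fin.toℕ<n i) , toℕ a , Fin.toℕ<n a , refl

hubEdges-joins : ∀ {L m i a} → i ≤ L → a ℕ.< m → Any (λ e → lo e ≡ i × hi e ≡ suc L ℕ.+ a) (hubEdges L m)
hubEdges-joins {L} i≤L a<m = lose
  (∈-cartesianProductWith⁺ (hubEdge L) (∈-allFin (fromℕ< (s≤s i≤L))) (∈-allFin (fromℕ< a<m)))
  (Fin.toℕ-fromℕ< (s≤s i≤L) , cong (suc L ℕ.+_) (Fin.toℕ-fromℕ< a<m))

hubEdges-unique : ∀ L m → Unique (hubEdges L m)
hubEdges-unique L m = Unique.cartesianProductWith⁺ (hubEdge L)
  (λ eq → Fin.toℕ-injective (cong lo eq) , Fin.toℕ-injective (ℕ.+-cancelˡ-≡ (suc L) _ _ (cong hi eq)))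
  (Unique.allFin⁺ (suc L)) (Unique.allFin⁺ m)

∈-spokes⁻ : ∀ {l e} → e ∈ spokes l → lo e ≡ 0 × hi e ≤ l
∈-spokes⁻ {suc l} (here refl) = refl , ℕ.≤-refl
∈-spokes⁻ {suc l} (there e∈) with ∈-spokes⁻ e∈
... | lo≡0 , hi≤l = lo≡0 , ℕ.m≤n⇒m≤1+n hi≤l

spokes-join : ∀ {l i} → i ℕ.< l → Any (λ e → lo e ≡ 0 × hi e ≡ suc i) (spokes l)
spokes-join {suc l} {i} i<1+l with i ℕ.≟ l
... | yes refl = here (refl , refl)
... | no  i≢l  = there (spokes-join (ℕ.≤∧≢⇒< (ℕ.≤-pred i<1+l) i≢l))

spokes-fresh : ∀ l → edge 0 (suc l) (s≤s z≤n) ∉ spokes l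
spokes-fresh l e∈ = ℕ.1+n≰n (proj₂ (∈-spokes⁻ e∈))

spokes-unique : ∀ l → Unique (spokes l)
spokes-unique zero    = []
spokes-unique (suc l) = All.tabulate (λ { e∈ refl → spokes-fresh l e∈ }) ∷ spokes-unique l

gadget-isGraph : ∀ {L} m {l} → l ≤ L → IsGraph (gadgetNodes L m) (hubEdges L m ++ spokes l)
gadget-isGraph {L} m {l} l≤L = record
  { nodes-unique = Unique.upTo⁺ (suc L ℕ.+ m)
  ; edges-unique = Unique.++⁺ (hubEdges-unique L m) (spokes-unique l) disjoint
  ; endpoints    = λ {e} e∈ → endpoints (∈-++⁻ (hubEdges L m) e∈)
  }
  where
  below : ∀ {i} → i ≤ L → i ∈ gadgetNodes L m
  below i≤L = ∈-upTo⁺ (ℕ.≤-trans (s≤s i≤L) (ℕ.m≤m+n (suc L) m))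
  disjoint : ∀ {e} → ¬ (e ∈ hubEdges L m × e ∈ spokes l)
  disjoint (e∈h , e∈s) with ∈-hubEdges⁻ {L} e∈h
  ... | _ , a , _ , hi≡ = ℕ.<⇒≱ (s≤s (ℕ.m≤m+n L a)) (ℕ.≤-trans (subst (_≤ l) hi≡ (proj₂ (∈-spokes⁻ e∈s))) l≤L)
  endpoints : ∀ {e} → e ∈ hubEdges L m ⊎ e ∈ spokes l → lo e ∈ gadgetNodes L m × hi e ∈ gadgetNodes L m
  endpoints (inj₁ e∈) with ∈-hubEdges⁻ {L} e∈
  ... | lo≤L , a , a<m , hi≡ = below lo≤L , subst (_∈ gadgetNodes L m) (sym hi≡) (∈-upTo⁺ (ℕ.+-monoʳ-< (suc L) a<m))
  endpoints (inj₂ e∈) with ∈-spokes⁻ e∈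
  ... | lo≡0 , hi≤l = subst (_∈ gadgetNodes L m) (sym lo≡0) (below z≤n) , below (ℕ.≤-trans hi≤l l≤L)

hubGraph : ℕ → ℕ → Graph
hubGraph L m = mkGraph (gadgetNodes L m) (hubEdges L m)
  (subst (IsGraph (gadgetNodes L m)) (++-identityʳ (hubEdges L m)) (gadget-isGraph m z≤n))

hubSequence : ∀ {T} L m → GraphSequence T
hubSequence L m = record
  { initial = hubGraph L m
  ; ∂V      = λ _ → []
  ; ∂E      = λ _ → []
  ; valid   = λ t → subst₂ IsGraph (sym (accumulate-[] (gadgetNodes L m) t)) (sym (accumulate-[] (hubEdges L m) t))
                      (isGraph (hubGraph L m))
  }

-- With no spokes the sequence must be literally the same for every `j`, since the T events are
-- packed under one law; `single j []` agrees with the empty insertion only pointwise.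
insertSpokes : ∀ {T} L m → Fin T → (l : ℕ) → l ≤ L → GraphSequence T
insertSpokes L m j zero    l≤L = hubSequence L m
insertSpokes L m j (suc l) l≤L = record
  { initial = hubGraph L m
  ; ∂V      = λ _ → []
  ; ∂E      = single j (spokes (suc l))
  ; valid   = λ t → subst (λ V → IsGraph V (accumulate (hubEdges L m) (single j (spokes (suc l))) t))
                      (sym (accumulate-[] (gadgetNodes L m) t)) (valid-edges t)
  }
  where
  valid-edges : ∀ t → IsGraph (gadgetNodes L m) (accumulate (hubEdges L m) (single j (spokes (suc l))) t)
  valid-edges t with ℕ.<-≤-connex (toℕ t) (toℕ j)
  ... | inj₁ t<j = subst (IsGraph (gadgetNodes L m)) (sym (accumulate-before (hubEdges L m) t<j)) (isGraph (hubGraph L m))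
  ... | inj₂ j≤t = subst (IsGraph (gadgetNodes L m)) (sym (accumulate-from (hubEdges L m) j≤t)) (gadget-isGraph m l≤L)

-- The insertions are given by pointwise equations to cover the removal of the last spoke, where the
-- smaller sequence is `hubSequence`.
oneMoreEdge : ∀ {T} (𝒢 𝒢′ : GraphSequence T) j e B → initial 𝒢 ≡ initial 𝒢′ → (∀ t → ∂V 𝒢 t ≡ ∂V 𝒢′ t) →
  (∀ t → ∂E 𝒢 t ≡ single j (e ∷ B) t) → (∀ t → ∂E 𝒢′ t ≡ single j B t) → e ∉ B → OneMoreEdge 𝒢 𝒢′
oneMoreEdge 𝒢 𝒢′ j e B init≡ ∂V≡ ∂E≡ ∂E′≡ e∉B = record
  { same-nodes₀ = ≋-reflexive (cong nodes init≡)
  ; same-edges₀ = ≋-reflexive (cong edges init≡)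
  ; same-∂V     = λ t → ≋-reflexive (∂V≡ t)
  ; e*          = e
  ; t*          = j
  ; same-∂E     = λ t t≢j → ≋-reflexive (trans (∂E≡ t) (trans (single-off j t (e ∷ B) t≢j)
                    (sym (trans (∂E′≡ t) (single-off j t B t≢j)))))
  ; subset      = λ x∈ → subst (_ ∈_) (sym at) (there (subst (_ ∈_) at′ x∈))
  ; difference  = λ x → mk⇔
      (λ (x∈ , x∉) → new (subst (x ∈_) at x∈) (x∉ ∘ subst (x ∈_) (sym at′)))
      (λ { refl → subst (x ∈_) (sym at) (here refl) , e∉B ∘ subst (x ∈_) at′ })
  }
  where
  at : ∂E 𝒢 j ≡ e ∷ B
  at = trans (∂E≡ j) (single-at j (e ∷ B))
  at′ : ∂E 𝒢′ j ≡ B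
  at′ = trans (∂E′≡ j) (single-at j B)
  new : ∀ {x} → x ∈ e ∷ B → x ∉ B → x ≡ e
  new (here x≡e)  _   = x≡e
  new (there x∈B) x∉B = ⊥-elim (x∉B x∈B)

insertSpokes-adjacent : ∀ {T} L m (j : Fin T) l l<L l≤L →
  EdgeAdjacent (insertSpokes L m j (suc l) l<L) (insertSpokes L m j l l≤L)
insertSpokes-adjacent L m j zero    l<L l≤L = inj₁ (oneMoreEdge
  (insertSpokes L m j 1 l<L) (insertSpokes L m j 0 l≤L) j _ _
  refl (λ _ → refl) (λ _ → refl) (λ t → sym (single-[] j t)) (spokes-fresh 0))
insertSpokes-adjacent L m j (suc l) l<L l≤L = inj₁ (oneMoreEdge
  (insertSpokes L m j (suc (suc l)) l<L) (insertSpokes L m j (suc l) l≤L) j _ _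
  refl (λ _ → refl) (λ _ → refl) (λ _ → refl) (spokes-fresh (suc l)))

insertSpokes-nodes : ∀ {T} L m (j : Fin T) l l≤L t → nodes (graphAt (insertSpokes L m j l l≤L) t) ≡ gadgetNodes L m
insertSpokes-nodes L m j zero    l≤L t = accumulate-[] (gadgetNodes L m) t
insertSpokes-nodes L m j (suc l) l≤L t = accumulate-[] (gadgetNodes L m) t

insertSpokes-before : ∀ {T} L m (j : Fin T) l l≤L {t} → t Fin.< j →
  edges (graphAt (insertSpokes L m j l l≤L) t) ≡ hubEdges L m
insertSpokes-before L m j zero    l≤L {t} t<j = accumulate-[] (hubEdges L m) t
insertSpokes-before L m j (suc l) l≤L     t<j = accumulate-before (hubEdges L m) t<j

insertSpokes-from : ∀ {T} L m (j : Fin T) l l≤L {t} → j Fin.≤ t →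
  edges (graphAt (insertSpokes L m j l l≤L) t) ≡ hubEdges L m ++ spokes l
insertSpokes-from L m j zero    l≤L {t} j≤t = trans (accumulate-[] (hubEdges L m) t) (sym (++-identityʳ (hubEdges L m)))
insertSpokes-from L m j (suc l) l≤L     j≤t = accumulate-from (hubEdges L m) j≤t

-- Effect of the spokes on the statistics

combinations-mono : {A B : Set} → ∀ k (xs : List A) (ys : List B) → length xs ≤ length ys →
                    length (combinations k xs) ≤ length (combinations k ys)
combinations-mono zero    xs ys xs≤ys = ℕ.≤-refl
combinations-mono (suc k) [] ys xs≤ys = z≤n
combinations-mono (suc k) (x ∷ xs) (y ∷ ys) (s≤s xs≤ys) = begin
  length (map (x ∷_) (combinations k xs) ++ combinations (suc k) xs)
    ≡⟨ trans (length-++ (map (x ∷_) (combinations k xs))) (cong (ℕ._+ _) (length-map (x ∷_) (combinations k xs))) ⟩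
  length (combinations k xs) ℕ.+ length (combinations (suc k) xs)
    ≤⟨ ℕ.+-mono-≤ (combinations-mono k xs ys xs≤ys) (combinations-mono (suc k) xs ys xs≤ys) ⟩
  length (combinations k ys) ℕ.+ length (combinations (suc k) ys)
    ≡⟨ trans (length-++ (map (y ∷_) (combinations k ys))) (cong (ℕ._+ _) (length-map (y ∷_) (combinations k ys))) ⟨
  length (map (y ∷_) (combinations k ys) ++ combinations (suc k) ys) ∎
  where open ℕ.≤-Reasoning

combinations-short : {A : Set} → ∀ {k} (xs : List A) → length xs ℕ.< k → combinations k xs ≡ []
combinations-short {k = suc k} []       _ = refl
combinations-short {k = suc k} (x ∷ xs) (s≤s xs<k) = cong₂ (λ ys zs → map (x ∷_) ys ++ zs)
  (combinations-short xs xs<k) (combinations-short xs (ℕ.m≤n⇒m≤1+n xs<k))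

combinations-inhabited : {A : Set} → ∀ {k} (xs : List A) → k ≤ length xs → 0 ℕ.< length (combinations k xs)
combinations-inhabited {k = zero} xs _ = s≤s z≤n
combinations-inhabited {k = suc k} (x ∷ xs) (s≤s k≤xs) = begin
  1                                                        ≤⟨ combinations-inhabited xs k≤xs ⟩
  length (combinations k xs)                               ≡⟨ length-map (x ∷_) (combinations k xs) ⟨
  length (map (x ∷_) (combinations k xs))                  ≤⟨ ℕ.m≤m+n _ _ ⟩
  length (map (x ∷_) (combinations k xs)) ℕ.+ length (combinations (suc k) xs)
                                                           ≡⟨ length-++ (map (x ∷_) (combinations k xs)) ⟨
  length (map (x ∷_) (combinations k xs) ++ combinations (suc k) xs) ∎
  where open ℕ.≤-Reasoning

concatMap-mono : {A B : Set} (h h′ : A → List B) → (∀ x → length (h x) ≤ length (h′ x)) →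
                 ∀ xs → length (concatMap h xs) ≤ length (concatMap h′ xs)
concatMap-mono h h′ h≤h′ []       = z≤n
concatMap-mono h h′ h≤h′ (x ∷ xs) = subst₂ _≤_ (sym (length-++ (h x))) (sym (length-++ (h′ x)))
  (ℕ.+-mono-≤ (h≤h′ x) (concatMap-mono h h′ h≤h′ xs))

concatMap-gain : {A B : Set} (h h′ : A → List B) → (∀ x → length (h x) ≤ length (h′ x)) →
  ∀ L n f → (∀ i → i ℕ.< L → length (h (f i)) ℕ.< length (h′ (f i))) →
  length (concatMap h (applyUpTo f (L ℕ.+ n))) ℕ.+ L ≤ length (concatMap h′ (applyUpTo f (L ℕ.+ n)))
concatMap-gain h h′ h≤h′ zero    n f gain =
  ℕ.≤-trans (ℕ.≤-reflexive (ℕ.+-identityʳ _)) (concatMap-mono h h′ h≤h′ (applyUpTo f n))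
concatMap-gain h h′ h≤h′ (suc L) n f gain = begin
  length (h (f 0) ++ rest h) ℕ.+ suc L
    ≡⟨ cong (ℕ._+ suc L) (length-++ (h (f 0))) ⟩
  length (h (f 0)) ℕ.+ length (rest h) ℕ.+ suc L
    ≡⟨ solve 3 (λ a b c → a :+ b :+ (con 1 :+ c) := con 1 :+ a :+ (b :+ c)) refl (length (h (f 0))) (length (rest h)) L ⟩
  suc (length (h (f 0))) ℕ.+ (length (rest h) ℕ.+ L)
    ≤⟨ ℕ.+-mono-≤ (gain 0 (s≤s z≤n)) (concatMap-gain h h′ h≤h′ L n (f ∘ suc) (λ i i<L → gain (suc i) (s≤s i<L))) ⟩
  length (h′ (f 0)) ℕ.+ length (rest h′)
    ≡⟨ length-++ (h′ (f 0)) ⟨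
  length (h′ (f 0) ++ rest h′) ∎
  where
  open ℕ.≤-Reasoning
  open ℕ-Solver.+-*-Solver
  rest = λ g → concatMap g (applyUpTo (f ∘ suc) (L ℕ.+ n))

module Gain (L m : ℕ) (G G′ : Graph)
            (nodes≡ : nodes G ≡ gadgetNodes L m) (nodes′≡ : nodes G′ ≡ gadgetNodes L m)
            (edges≡ : edges G ≡ hubEdges L m) (edges′≡ : edges G′ ≡ hubEdges L m ++ spokes L) where

  same-node : ∀ {v} → v ∈ nodes G → v ∈ nodes G′
  same-node = subst (_ ∈_) (trans nodes≡ (sym nodes′≡))

  node : ∀ {v} → v ℕ.< suc L ℕ.+ m → v ∈ nodes G
  node = subst (_ ∈_) (sym nodes≡) ∘ ∈-upTo⁺

  tip-node : ∀ {i} → i ℕ.< L → suc i ∈ nodes G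
  tip-node i<L = node (s≤s (ℕ.≤-trans i<L (ℕ.m≤m+n L m)))

  unique : Unique (nodes G)
  unique = IsGraph.nodes-unique (isGraph G)

  unique′ : Unique (nodes G′)
  unique′ = IsGraph.nodes-unique (isGraph G′)

  adjacent-mono : ∀ {u v} → Adjacent G u v → Adjacent G′ u v
  adjacent-mono = subst (Any _) (sym edges′≡) ∘ Any.++⁺ˡ ∘ subst (Any _) edges≡

  adjacent-hub : ∀ {i a} → i ≤ L → a ℕ.< m → Adjacent G i (suc L ℕ.+ a)
  adjacent-hub i≤L a<m = subst (Any _) (sym edges≡) (Any.map inj₁ (hubEdges-joins i≤L a<m))

  adjacent-tip : ∀ {i} → i ℕ.< L → Adjacent G′ 0 (suc i)
  adjacent-tip i<L = subst (Any _) (sym edges′≡) (Any.++⁺ʳ (hubEdges L m) (Any.map inj₁ (spokes-join i<L)))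

  IsHub : Node → Set
  IsHub v = ∃[ a ] (a ℕ.< m × v ≡ suc L ℕ.+ a)

  hub≰ : ∀ {v} → IsHub v → ¬ (v ≤ L)
  hub≰ (a , _ , refl) = ℕ.<⇒≱ (s≤s (ℕ.m≤m+n L a))

  adjacent⁻ : ∀ {u v} → Adjacent G u v → (u ≤ L × IsHub v) ⊎ (v ≤ L × IsHub u)
  adjacent⁻ adj with find (subst (Any _) edges≡ adj)
  ... | e , e∈ , joins with ∈-hubEdges⁻ {L} e∈
  ... | lo≤L , a , a<m , hi≡ with joins
  ... | inj₁ (refl , refl) = inj₁ (lo≤L , a , a<m , hi≡)
  ... | inj₂ (refl , refl) = inj₂ (lo≤L , a , a<m , hi≡)

  degree-mono : ∀ v → degree G v ≤ degree G′ v
  degree-mono v = ⊆⇒length-≤ (Unique.filter⁺ (adjacent? G v) unique) λ u∈ →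
    let u∈G , adj = ∈-filter⁻ (adjacent? G v) u∈
    in ∈-filter⁺ (adjacent? G′ v) (same-node u∈G) (adjacent-mono adj)

  hubs : List Node
  hubs = applyUpTo (suc L ℕ.+_) m

  degree-tip : ∀ {i} → i ℕ.< L → degree G (suc i) ≤ m
  degree-tip {i} i<L = ℕ.≤-trans
    (⊆⇒length-≤ (Unique.filter⁺ (adjacent? G (suc i)) unique) λ u∈ →
      hub (adjacent⁻ (proj₂ (∈-filter⁻ (adjacent? G (suc i)) {xs = nodes G} u∈))))
    (ℕ.≤-reflexive (length-applyUpTo (suc L ℕ.+_) m))
    where
    hub : ∀ {u} → (suc i ≤ L × IsHub u) ⊎ (u ≤ L × IsHub (suc i)) → u ∈ hubs
    hub (inj₁ (_ , a , a<m , refl)) = ∈-applyUpTo⁺ (suc L ℕ.+_) a<m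
    hub (inj₂ (_ , isHub))          = ⊥-elim (hub≰ isHub i<L)

  degree′-tip : ∀ {i} → i ℕ.< L → m ℕ.< degree G′ (suc i)
  degree′-tip {i} i<L = ℕ.≤-trans
    (ℕ.≤-reflexive (cong suc (sym (length-applyUpTo (suc L ℕ.+_) m))))
    (⊆⇒length-≤
      (All.tabulate (λ u∈ 0≡u → hub≰ (∈-applyUpTo⁻ (suc L ℕ.+_) u∈) (subst (_≤ L) 0≡u z≤n))
        ∷ Unique.applyUpTo⁺₁ (suc L ℕ.+_) m (λ a<b _ → ℕ.<⇒≢ a<b ∘ ℕ.+-cancelˡ-≡ (suc L) _ _))
      neighbour)
    where
    neighbour : 0 ∷ hubs ⊆ neighbours G′ (suc i)
    neighbour (here refl) = ∈-filter⁺ (adjacent? G′ (suc i)) (same-node (node (s≤s z≤n))) (Any.map swap (adjacent-tip i<L))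
    neighbour (there u∈) with ∈-applyUpTo⁻ (suc L ℕ.+_) u∈
    ... | a , a<m , refl = ∈-filter⁺ (adjacent? G′ (suc i)) (same-node (node (ℕ.+-monoʳ-< (suc L) a<m)))
                             (adjacent-mono (adjacent-hub i<L a<m))

  -- No tip is high at first, so the tips and the old high nodes form a list without repetition; as
  -- degrees only grow, all of it is high afterwards.
  highDegreeNodes-gain : value (highDegreeNodes (suc m)) G tt ℕ.+ L ≤ value (highDegreeNodes (suc m)) G′ tt
  highDegreeNodes-gain = begin
    length (filter high? (nodes G)) ℕ.+ L
      ≡⟨ ℕ.+-comm _ L ⟩
    L ℕ.+ length (filter high? (nodes G))
      ≡⟨ cong (λ n → n ℕ.+ length (filter high? (nodes G))) (length-applyUpTo suc L) ⟨
    length (applyUpTo suc L) ℕ.+ length (filter high? (nodes G))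
      ≡⟨ length-++ (applyUpTo suc L) ⟨
    length (applyUpTo suc L ++ filter high? (nodes G))
      ≤⟨ ⊆⇒length-≤
           (Unique.++⁺ (Unique.applyUpTo⁺₁ suc L λ i<j _ → ℕ.<⇒≢ i<j ∘ ℕ.suc-injective)
             (Unique.filter⁺ high? unique) disjoint)
           (λ v∈ → still-high (∈-++⁻ (applyUpTo suc L) v∈)) ⟩
    length (filter high′? (nodes G′)) ∎
    where
    open ℕ.≤-Reasoning
    high? = λ v → suc m ℕ.≤? degree G v
    high′? = λ v → suc m ℕ.≤? degree G′ v
    disjoint : ∀ {v} → ¬ (v ∈ applyUpTo suc L × v ∈ filter high? (nodes G))
    disjoint (v∈ , v∈G) with ∈-applyUpTo⁻ suc v∈
    ... | i , i<L , refl = ℕ.<⇒≱ (proj₂ (∈-filter⁻ high? {xs = nodes G} v∈G)) (degree-tip i<L)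
    still-high : ∀ {v} → v ∈ applyUpTo suc L ⊎ v ∈ filter high? (nodes G) → v ∈ filter high′? (nodes G′)
    still-high (inj₁ v∈) with ∈-applyUpTo⁻ suc v∈
    ... | i , i<L , refl = ∈-filter⁺ high′? (same-node (tip-node i<L)) (degree′-tip i<L)
    still-high (inj₂ v∈) with ∈-filter⁻ high? v∈
    ... | v∈G , high = ∈-filter⁺ high′? (same-node v∈G) (ℕ.≤-trans high (degree-mono _))

  edgeCount-gain : value edgeCount G tt ℕ.+ L ≤ value edgeCount G′ tt
  edgeCount-gain rewrite edges≡ | edges′≡ = ℕ.≤-reflexive
    (sym (trans (length-++ (hubEdges L m)) (cong (λ n → length (hubEdges L m) ℕ.+ n) (length-spokes L))))
    where
    length-spokes : ∀ l → length (spokes l) ≡ l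
    length-spokes zero    = refl
    length-spokes (suc l) = cong suc (length-spokes l)

  -- After the centre 0 the node list has the L tips, then the hubs. A tip has at most m neighbours
  -- before, so it centres no star, and more than m afterwards, so it centres at least one; the
  -- other nodes lose none.
  starCount-gain : value (starCount (suc m)) G tt ℕ.+ L ≤ value (starCount (suc m)) G′ tt
  starCount-gain = subst₂ (λ V V′ → length (concatMap at V) ℕ.+ L ≤ length (concatMap at′ V′))
    (sym nodes≡) (sym nodes′≡) (begin
    length (at 0 ++ rest at) ℕ.+ L
      ≡⟨ trans (cong (ℕ._+ L) (length-++ (at 0))) (ℕ.+-assoc (length (at 0)) _ L) ⟩
    length (at 0) ℕ.+ (length (rest at) ℕ.+ L)
      ≤⟨ ℕ.+-mono-≤ (at≤at′ 0) (concatMap-gain at at′ at≤at′ L m suc (λ i i<L → at<at′ i<L)) ⟩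
    length (at′ 0) ℕ.+ length (rest at′)
      ≡⟨ length-++ (at′ 0) ⟨
    length (at′ 0 ++ rest at′) ∎)
    where
    open ℕ.≤-Reasoning
    at at′ : Node → List (Node × List Node)
    at  v = map (v ,_) (combinations (suc m) (neighbours G v))
    at′ v = map (v ,_) (combinations (suc m) (neighbours G′ v))
    rest = λ g → concatMap g (applyUpTo suc (L ℕ.+ m))
    at≤at′ : ∀ v → length (at v) ≤ length (at′ v)
    at≤at′ v = subst₂ _≤_ (sym (length-map (v ,_) (combinations (suc m) (neighbours G v))))
                          (sym (length-map (v ,_) (combinations (suc m) (neighbours G′ v))))
                 (combinations-mono (suc m) (neighbours G v) (neighbours G′ v) (degree-mono v))
    at<at′ : ∀ {i} → i ℕ.< L → length (at (suc i)) ℕ.< length (at′ (suc i))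
    at<at′ {i} i<L rewrite combinations-short (neighbours G (suc i)) (s≤s (degree-tip i<L)) =
      subst (0 ℕ.<_) (sym (length-map {B = Node × List Node} (suc i ,_) (combinations (suc m) (neighbours G′ (suc i)))))
        (combinations-inhabited (neighbours G′ (suc i)) (degree′-tip i<L))

  -- Every edge leads from a node at most L up to a hub. In u < v < w the middle corner would be the
  -- upper end of one edge and the lower end of another.
  no-triangle : ∀ uvw → ¬ IsTriangle G uvw
  no-triangle (u , v , w) (u<v , v<w , uv , vw , _) with adjacent⁻ uv | adjacent⁻ vw
  ... | inj₁ (_ , hub-v)   | inj₁ (v≤L , _)   = hub≰ hub-v v≤L
  ... | inj₁ (_ , hub-v)   | inj₂ (w≤L , _)   = hub≰ hub-v (ℕ.≤-trans (ℕ.<⇒≤ v<w) w≤L)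
  ... | inj₂ (v≤L , hub-u) | _                = hub≰ hub-u (ℕ.≤-trans (ℕ.<⇒≤ u<v) v≤L)

triangleCount-gain : ∀ L G G′ → nodes G ≡ gadgetNodes L 1 → nodes G′ ≡ gadgetNodes L 1 →
  edges G ≡ hubEdges L 1 → edges G′ ≡ hubEdges L 1 ++ spokes L →
  value triangleCount G tt ℕ.+ L ≤ value triangleCount G′ tt
triangleCount-gain L G G′ n≡ n′≡ e≡ e′≡ = begin
  length (triangles G) ℕ.+ L
    ≡⟨ cong (λ ts → length ts ℕ.+ L) (filter-none (isTriangle? G)
         (All.universal no-triangle (cartesianProduct (nodes G) (cartesianProduct (nodes G) (nodes G))))) ⟩
  L
    ≡⟨ length-applyUpTo tip L ⟨
  length (applyUpTo tip L)
    ≤⟨ ⊆⇒length-≤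
         (Unique.applyUpTo⁺₁ tip L λ i<j _ → ℕ.<⇒≢ i<j ∘ ℕ.suc-injective ∘ cong (proj₁ ∘ proj₂))
         tip-triangle ⟩
  length (triangles G′) ∎
  where
  open ℕ.≤-Reasoning
  open Gain L 1 G G′ n≡ n′≡ e≡ e′≡
  -- The only hub exceeds all other nodes, so the corners are in increasing order; `+ 0` keeps it in
  -- the form `suc L ℕ.+ a` of `hubEdges-joins`.
  tip : ℕ → Node × Node × Node
  tip i = 0 , suc i , suc L ℕ.+ 0
  tip-triangle : applyUpTo tip L ⊆ triangles G′
  tip-triangle t∈ with ∈-applyUpTo⁻ tip t∈
  ... | i , i<L , refl = ∈-filter⁺ (isTriangle? G′)
    (∈-cartesianProduct⁺ (same-node (node (s≤s z≤n)))
      (∈-cartesianProduct⁺ (same-node (tip-node i<L)) (same-node (node (ℕ.+-monoʳ-< (suc L) (s≤s z≤n))))))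
    (s≤s z≤n , s≤s (ℕ.≤-trans i<L (ℕ.m≤m+n L 0)) , adjacent-tip i<L ,
      adjacent-mono (adjacent-hub i<L (s≤s z≤n)) , adjacent-mono (adjacent-hub z≤n (s≤s z≤n)))

-- The count falls from L + 1 to at most 1. Allowing for the centre keeps this right at L = 0, where
-- it stays isolated.
isolated-loss : ∀ L G G′ → nodes G ≡ gadgetNodes L 0 → nodes G′ ≡ gadgetNodes L 0 →
  edges G ≡ hubEdges L 0 → edges G′ ≡ hubEdges L 0 ++ spokes L →
  value degreeHistogram G′ 0 ℕ.+ L ≤ value degreeHistogram G 0
isolated-loss L G G′ n≡ n′≡ e≡ e′≡ = begin
  length (filter isolated′? (nodes G′)) ℕ.+ L
    ≤⟨ ℕ.+-monoˡ-≤ L (⊆⇒length-≤ {ys = 0 ∷ []} (Unique.filter⁺ isolated′? unique′) centre) ⟩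
  suc L                                        ≡⟨ ℕ.+-identityʳ (suc L) ⟨
  suc L ℕ.+ 0                                  ≡⟨ length-applyUpTo id (suc L ℕ.+ 0) ⟨
  length (gadgetNodes L 0)                     ≡⟨ cong length n≡ ⟨
  length (nodes G)                             ≤⟨ ⊆⇒length-≤ unique (λ {v} v∈ → ∈-filter⁺ isolated? v∈ (isolated v)) ⟩
  length (filter isolated? (nodes G))          ∎
  where
  open ℕ.≤-Reasoning
  open Gain L 0 G G′ n≡ n′≡ e≡ e′≡
  isolated? = λ v → degree G v ℕ.≟ 0
  isolated′? = λ v → degree G′ v ℕ.≟ 0
  isolated : ∀ v → degree G v ≡ 0
  isolated v = cong length (filter-none (adjacent? G v) (All.universal (λ u adj → no-hub (adjacent⁻ adj)) (nodes G)))
    where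
    no-hub : ∀ {u} → ¬ ((v ≤ L × IsHub u) ⊎ (u ≤ L × IsHub v))
    no-hub (inj₁ (_ , _ , () , _))
    no-hub (inj₂ (_ , _ , () , _))
  centre : filter isolated′? (nodes G′) ⊆ 0 ∷ []
  centre {zero}  _  = here refl
  centre {suc i} v∈ with ∈-filter⁻ isolated′? {xs = nodes G′} v∈
  ... | v∈G′ , degree≡0 = ⊥-elim (ℕ.<⇒≢ (degree′-tip (subst (i ℕ.<_) (ℕ.+-identityʳ L)
    (ℕ.≤-pred (∈-upTo⁻ (subst (suc i ∈_) n′≡ v∈G′))))) (sym degree≡0))

-- Error lower bounds for private algorithms

-- Graphs enter only through their lists because `graphAt` yields `accumulate` expressions with
-- their own validity proofs. The second alternative serves the histogram, whose entry 0 decreases.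
Separates : ℕ → ℕ → (Q : Statistic) → Index Q → Set
Separates L m Q i = ∀ G G′ → nodes G ≡ gadgetNodes L m → nodes G′ ≡ gadgetNodes L m →
  edges G ≡ hubEdges L m → edges G′ ≡ hubEdges L m ++ spokes L →
  value Q G i ℕ.+ L ≤ value Q G′ i ⊎ value Q G′ i ℕ.+ L ≤ value Q G i

module _ {T : ℕ} {Q : Statistic} (L m : ℕ) where

  -- Each removed spoke costs a factor of at most M, the integer bound on exp ε, so the power of M
  -- in the rational lower bound drops with `l`.
  groupPrivacy : ∀ ε (𝒜 : Algorithm T Q) → EdgeDifferentiallyPrivate ε 𝒜 →
    ∀ M → 0 ℕ.< M → Eventually (λ n → ∣ seq (exp ε) n ∣ ≤ℚ ℕ→ℚ M) →
    ∀ j S l l≤L q → ℚ→ℝ (ℕ→ℚ (M ℕ.^ l) * q) ≤ℝ Pr (law 𝒜 (insertSpokes L m j l l≤L)) S →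
    ℚ→ℝ q ≤ℝ Pr (law 𝒜 (hubSequence L m)) S
  groupPrivacy ε 𝒜 dp M 0<M exp≤M j S zero    l≤L q h =
    subst (λ z → ℚ→ℝ z ≤ℝ Pr (law 𝒜 (hubSequence L m)) S) (ℚ.*-identityˡ q) h
  groupPrivacy ε 𝒜 dp M 0<M exp≤M j S (suc l) l<L q h =
    groupPrivacy ε 𝒜 dp M 0<M exp≤M j S l l≤L q
      (*ℝ-cancel-lower (Pr (law 𝒜 (insertSpokes L m j (suc l) l<L)) S) (Pr (law 𝒜 (insertSpokes L m j l l≤L)) S)
        (exp ε) (ℕ→ℚ (M ℕ.^ l) * q) (ℕ→ℚ-mono-< 0<M) exp≤M
        (ProbabilityMeasure.Pr-nonneg (law 𝒜 (insertSpokes L m j l l≤L)) S)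
        (dp (insertSpokes L m j (suc l) l<L) (insertSpokes L m j l l≤L) (insertSpokes-adjacent L m j l l<L l≤L) S)
        (subst (λ z → ℚ→ℝ z ≤ℝ Pr (law 𝒜 (insertSpokes L m j (suc l) l<L)) S)
          (trans (cong (_* q) (ℕ→ℚ-* M (M ℕ.^ l))) (ℚ.*-assoc (ℕ→ℚ M) (ℕ→ℚ (M ℕ.^ l)) q)) h))
    where
    l≤L : l ≤ L
    l≤L = ℕ.<⇒≤ l<L

  accurateAt : ℝ → Fin T → OutputEvent T Q
  accurateAt α j = errorAtMost Q α (insertSpokes L m j L ℕ.≤-refl)

  module _ {i : Index Q} (separates : Separates L m Q i) (α : ℝ) {δ x : ℚ} (0<δ : 0ℚ < δ)
           (α<x : Eventually (λ n → seq α n + δ ≤ℚ x)) (2x≤L : x + x ≤ℚ ℕ→ℚ L) where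

    gap : ∀ {a b} → a ℕ.+ L ≤ b → x + x ≤ℚ ℕ→ℚ b - ℕ→ℚ a
    gap {a} {b} a+L≤b = linear (ℚ.+-mono-≤ 2x≤L (subst (_≤ℚ ℕ→ℚ b) (ℕ→ℚ-+ a L) (ℕ→ℚ-mono a+L≤b)))
      (solve 4 (λ x l a b → l :+ b :- (x :+ x :+ (a :+ l)) := b :- a :- (x :+ x)) refl x (ℕ→ℚ L) (ℕ→ℚ a) (ℕ→ℚ b))
      where open +-*-Solver

    -- At the earlier time s the batch due at t is still missing while the other is complete. The
    -- output at s would be within α of two values at least L ≥ 2x > 2α apart.
    accurateAt-disjoint-< : ∀ {s t} → s Fin.< t → ∀ o → o ∈ᴱ accurateAt α s → ¬ (o ∈ᴱ accurateAt α t)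
    accurateAt-disjoint-< {s} {t} s<t o o∈s o∈t = conflict (separates before after
        (insertSpokes-nodes L m t L ℕ.≤-refl s) (insertSpokes-nodes L m s L ℕ.≤-refl s)
        (insertSpokes-before L m t L ℕ.≤-refl s<t) (insertSpokes-from L m s L ℕ.≤-refl ℕ.≤-refl))
      where
      before after : Graph
      before = graphAt (insertSpokes L m t L ℕ.≤-refl) s
      after  = graphAt (insertSpokes L m s L ℕ.≤-refl) s
      conflict : ¬ (value Q before i ℕ.+ L ≤ value Q after i ⊎ value Q after i ℕ.+ L ≤ value Q before i)
      conflict (inj₁ up)   = ∣∣-sum-lower (o s i) (ℕ→ℚ (value Q before i)) (ℕ→ℚ (value Q after i)) α
        0<δ α<x (gap up) (o∈t s i) (o∈s s i)
      conflict (inj₂ down) = ∣∣-sum-lower (o s i) (ℕ→ℚ (value Q after i)) (ℕ→ℚ (value Q before i)) α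
        0<δ α<x (gap down) (o∈s s i) (o∈t s i)

    accurateAt-disjoint : ∀ s t → s ≢ t → ∀ o → o ∈ᴱ accurateAt α s → ¬ (o ∈ᴱ accurateAt α t)
    accurateAt-disjoint s t s≢t o o∈s o∈t with Fin.<-cmp s t
    ... | tri< s<t _ _ = accurateAt-disjoint-< s<t o o∈s o∈t
    ... | tri≈ _ s≡t _ = s≢t s≡t
    ... | tri> _ _ t<s = accurateAt-disjoint-< t<s o o∈t o∈s

  -- If α < x, group privacy gives each of the T disjoint events probability at least p / M^L
  -- without any insertion, so packing yields T p ≤ M^L.
  privateErrorAtLeast : ∀ ε β {i} → Separates L m Q i →
    ∀ M → 0 ℕ.< M → Eventually (λ n → ∣ seq (exp ε) n ∣ ≤ℚ ℕ→ℚ M) →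
    ∀ p → ℚ→ℝ p ≤ℝ β → ℕ→ℚ (M ℕ.^ L) < ℕ→ℚ T * p →
    ∀ x → x + x ≤ℚ ℕ→ℚ L → PrivateErrorAtLeast ε β T Q (ℚ→ℝ x)
  privateErrorAtLeast ε β separates M 0<M exp≤M p p≤β M^L<Tp x 2x≤L 𝒜 dp α accurate =
    ≮ℝ⇒≥ℝ (ℚ→ℝ x) α λ (δ , 0<δ , α<x) →
      contradict (reciprocal (ℕ→ℚ (M ℕ.^ L)) 0<M^L) (accurateAt-disjoint separates α 0<δ α<x 2x≤L)
    where
    0<M^L : 0ℚ < ℕ→ℚ (M ℕ.^ L)
    0<M^L = ℕ→ℚ-mono-< (ℕ.m^n>0 M {{ℕ.>-nonZero 0<M}} L)
    contradict : ∃[ r ] (0ℚ < r × ℕ→ℚ (M ℕ.^ L) * r ≡ 1ℚ) →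
      ¬ (∀ s t → s ≢ t → ∀ o → o ∈ᴱ accurateAt α s → ¬ (o ∈ᴱ accurateAt α t))
    contradict (r , _ , M^L*r≡1) disjoint = <⇒≱ M^L<Tp (begin
      ℕ→ℚ T * p                             ≡⟨ cong (ℕ→ℚ T *_) M^L*rp≡p ⟨
      ℕ→ℚ T * (ℕ→ℚ (M ℕ.^ L) * (r * p))     ≡⟨ solve 3 (λ t m q → t :* (m :* q) := m :* (t :* q)) refl
                                                 (ℕ→ℚ T) (ℕ→ℚ (M ℕ.^ L)) (r * p) ⟩
      ℕ→ℚ (M ℕ.^ L) * (ℕ→ℚ T * (r * p))     ≤⟨ ℚ.*-monoˡ-≤-nonNeg (ℕ→ℚ (M ℕ.^ L)) {{ℚ.nonNegative (ℚ.<⇒≤ 0<M^L)}}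
                                                 (packing-Fin (law 𝒜 (hubSequence L m)) (accurateAt α) disjoint (r * p) lower) ⟩
      ℕ→ℚ (M ℕ.^ L) * 1ℚ                    ≡⟨ ℚ.*-identityʳ _ ⟩
      ℕ→ℚ (M ℕ.^ L)                         ∎)
      where
      open ℚ.≤-Reasoning
      open +-*-Solver
      M^L*rp≡p : ℕ→ℚ (M ℕ.^ L) * (r * p) ≡ p
      M^L*rp≡p = trans (sym (ℚ.*-assoc (ℕ→ℚ (M ℕ.^ L)) r p)) (trans (cong (_* p) M^L*r≡1) (ℚ.*-identityˡ p))
      lower : ∀ j → ℚ→ℝ (r * p) ≤ℝ Pr (law 𝒜 (hubSequence L m)) (accurateAt α j)
      lower j = groupPrivacy ε 𝒜 dp M 0<M exp≤M j (accurateAt α j) L ℕ.≤-refl (r * p)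
        (subst (λ z → ℚ→ℝ z ≤ℝ Pr (law 𝒜 (insertSpokes L m j L ℕ.≤-refl)) (accurateAt α j)) (sym M^L*rp≡p)
          (≤ℝ-trans (ℚ→ℝ p) β (Pr (law 𝒜 (insertSpokes L m j L ℕ.≤-refl)) (accurateAt α j)) p≤β
            (accurate (insertSpokes L m j L ℕ.≤-refl))))

-- Logarithms and the choice of the batch size

n<2^n : ∀ n → n ℕ.< 2 ℕ.^ n
n<2^n zero    = s≤s z≤n
n<2^n (suc n) = begin
  2 ℕ.+ n                        ≡⟨ ℕ.+-comm 1 (suc n) ⟩
  suc n ℕ.+ 1                    ≤⟨ ℕ.+-mono-≤ (n<2^n n) (ℕ.m^n>0 2 n) ⟩
  2 ℕ.^ n ℕ.+ 2 ℕ.^ n            ≡⟨ cong (2 ℕ.^ n ℕ.+_) (ℕ.+-identityʳ (2 ℕ.^ n)) ⟨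
  2 ℕ.^ suc n                    ∎
  where open ℕ.≤-Reasoning

-- Induction by halving: 2^⌊log₂ n⌋ ≤ 2 · 2^⌊log₂ ⌊n/2⌋⌋ ≤ 2 ⌊n/2⌋ ≤ n.
2^⌊log₂n⌋≤n : ∀ n → 0 ℕ.< n → 2 ℕ.^ ⌊log₂ n ⌋ ≤ n
2^⌊log₂n⌋≤n = <-rec (λ n → 0 ℕ.< n → 2 ℕ.^ ⌊log₂ n ⌋ ≤ n) step
  where
  open ℕ.≤-Reasoning
  2^k≤2*2^[k∸1] : ∀ k → 2 ℕ.^ k ≤ 2 ℕ.* 2 ℕ.^ (k ℕ.∸ 1)
  2^k≤2*2^[k∸1] zero    = s≤s z≤n
  2^k≤2*2^[k∸1] (suc k) = ℕ.≤-refl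
  step : ∀ n → (∀ {m} → m ℕ.< n → 0 ℕ.< m → 2 ℕ.^ ⌊log₂ m ⌋ ≤ m) → 0 ℕ.< n → 2 ℕ.^ ⌊log₂ n ⌋ ≤ n
  step (suc zero)        rec _ = ℕ.≤-refl
  step n@(suc (suc n-2)) rec _ = begin
    2 ℕ.^ ⌊log₂ n ⌋                        ≤⟨ 2^k≤2*2^[k∸1] ⌊log₂ n ⌋ ⟩
    2 ℕ.* 2 ℕ.^ (⌊log₂ n ⌋ ℕ.∸ 1)          ≡⟨ cong (λ k → 2 ℕ.* 2 ℕ.^ k) (⌊log₂⌊n/2⌋⌋≡⌊log₂n⌋∸1 n) ⟨
    2 ℕ.* 2 ℕ.^ ⌊log₂ ℕ.⌊ n /2⌋ ⌋          ≤⟨ ℕ.*-monoʳ-≤ 2 (rec (ℕ.⌊n/2⌋<n (suc n-2)) (s≤s z≤n)) ⟩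
    2 ℕ.* ℕ.⌊ n /2⌋                        ≡⟨ cong (ℕ.⌊ n /2⌋ ℕ.+_) (ℕ.+-identityʳ ℕ.⌊ n /2⌋) ⟩
    ℕ.⌊ n /2⌋ ℕ.+ ℕ.⌊ n /2⌋                ≤⟨ ℕ.+-monoʳ-≤ ℕ.⌊ n /2⌋ (ℕ.⌊n/2⌋≤⌈n/2⌉ n) ⟩
    ℕ.⌊ n /2⌋ ℕ.+ ℕ.⌈ n /2⌉                ≡⟨ ℕ.⌊n/2⌋+⌈n/2⌉≡n n ⟩
    n                                      ∎

-- L is the quotient of ℓ - (b + 1) by k, the 1 giving strictness. Rounding loses less than k, so ℓ
-- ≤ kL + (b + 1 + k); as the last term is at most ℓ/2, at least half of ℓ is left for kL.
batchSize : ∀ k′ b ℓ → let k = suc k′ in 2 ℕ.* (suc b ℕ.+ k) ≤ ℓ →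
  ∃[ L ] (k ℕ.* L ℕ.+ b ℕ.< ℓ × ℓ ≤ 2 ℕ.* k ℕ.* L)
batchSize k′ b ℓ large = L , below , above
  where
  open ℕ.≤-Reasoning
  open ℕ-Solver.+-*-Solver
  k D L : ℕ
  k = suc k′
  D = ℓ ℕ.∸ suc b
  L = D ℕ./ k
  D+b : D ℕ.+ suc b ≡ ℓ
  D+b = ℕ.m∸n+n≡m (ℕ.≤-trans (ℕ.m≤m+n (suc b) k) (ℕ.≤-trans (ℕ.m≤n*m (suc b ℕ.+ k) 2) large))
  below : k ℕ.* L ℕ.+ b ℕ.< ℓ
  below = begin
    suc (k ℕ.* L ℕ.+ b)   ≡⟨ ℕ.+-suc (k ℕ.* L) b ⟨
    k ℕ.* L ℕ.+ suc b     ≡⟨ cong (ℕ._+ suc b) (ℕ.*-comm k L) ⟩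
    L ℕ.* k ℕ.+ suc b     ≤⟨ ℕ.+-monoˡ-≤ (suc b) (m/n*n≤m D k) ⟩
    D ℕ.+ suc b           ≡⟨ D+b ⟩
    ℓ                     ∎
  D≤ : D ≤ k ℕ.+ L ℕ.* k
  D≤ = begin
    D                      ≡⟨ m≡m%n+[m/n]*n D k ⟩
    D ℕ.% k ℕ.+ L ℕ.* k    ≤⟨ ℕ.+-monoˡ-≤ (L ℕ.* k) (ℕ.<⇒≤ (m%n<n D k)) ⟩
    k ℕ.+ L ℕ.* k          ∎
  above : ℓ ≤ 2 ℕ.* k ℕ.* L
  above = ℕ.+-cancelˡ-≤ (2 ℕ.* (suc b ℕ.+ k)) ℓ (2 ℕ.* k ℕ.* L) (begin
    2 ℕ.* (suc b ℕ.+ k) ℕ.+ ℓ             ≤⟨ ℕ.+-monoˡ-≤ ℓ large ⟩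
    ℓ ℕ.+ ℓ                               ≡⟨ cong (λ z → z ℕ.+ z) D+b ⟨
    D ℕ.+ suc b ℕ.+ (D ℕ.+ suc b)         ≤⟨ ℕ.+-mono-≤ (ℕ.+-monoˡ-≤ (suc b) D≤) (ℕ.+-monoˡ-≤ (suc b) D≤) ⟩
    k ℕ.+ L ℕ.* k ℕ.+ suc b ℕ.+ (k ℕ.+ L ℕ.* k ℕ.+ suc b)
      ≡⟨ solve 3 (λ k l b → k :+ l :* k :+ b :+ (k :+ l :* k :+ b) := con 2 :* (b :+ k) :+ con 2 :* k :* l)
           refl k L (suc b) ⟩
    2 ℕ.* (suc b ℕ.+ k) ℕ.+ 2 ℕ.* k ℕ.* L ∎)

-- A power of two moves the comparison of M^L with T to the exponents; the successor keeps k
-- positive for the division in `batchSize`.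
2^-upper : ∀ (s : ℕ → ℚ) → ∃[ K ] (0ℚ < K × Eventually (λ n → ∣ s n ∣ ≤ℚ K)) →
           ∃[ k′ ] Eventually (λ n → ∣ s n ∣ ≤ℚ ℕ→ℚ (2 ℕ.^ suc k′))
2^-upper s (K , _ , s≤K) with archimedean K
... | N , K≤N = N , eventually (λ n h → ℚ.≤-trans {i = ∣ s n ∣} h (ℚ.≤-trans K≤N
  (ℕ→ℚ-mono (ℕ.≤-trans (ℕ.n≤1+n N) (ℕ.<⇒≤ (n<2^n (suc N))))))) s≤K

exp-upper : ∀ ε → ∃[ k′ ] Eventually (λ n → ∣ seq (exp ε) n ∣ ≤ℚ ℕ→ℚ (2 ℕ.^ suc k′))
exp-upper ε = 2^-upper (seq (exp ε)) (bounded {seq (exp ε)} (cauchy (exp ε)))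

module LowerBound (ε β : ℝ) (k′ b : ℕ) (p : ℚ) (0<p : 0ℚ < p) (p≤β : ℚ→ℝ p ≤ℝ β) (1≤p2^b : 1ℚ ≤ℚ p * ℕ→ℚ (2 ℕ.^ b))
         (exp≤2^k : Eventually (λ n → ∣ seq (exp ε) n ∣ ≤ℚ ℕ→ℚ (2 ℕ.^ suc k′))) where

  k : ℕ
  k = suc k′

  -- This is 1/(4k): `inv` adds one to its argument and so gives 1/(2k), matching ℓ ≤ 2kL, and ½
  -- reflects that the error is half the batch.
  rate : ℚ
  rate = inv (k′ ℕ.+ (k ℕ.+ 0)) * ½

  rate-pos : 0ℚ < rate
  rate-pos = half-pos (inv-pos (k′ ℕ.+ (k ℕ.+ 0)))

  rate-upper : ∀ {ℓ L} → ℓ ≤ 2 ℕ.* k ℕ.* L → rate * ℕ→ℚ ℓ + rate * ℕ→ℚ ℓ ≤ℚ ℕ→ℚ L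
  rate-upper {ℓ} {L} ℓ≤2kL = begin
    v * ½ * ℕ→ℚ ℓ + v * ½ * ℕ→ℚ ℓ    ≡⟨ solve 2 (λ v l → v :* con ½ :* l :+ v :* con ½ :* l := v :* l) refl v (ℕ→ℚ ℓ) ⟩
    v * ℕ→ℚ ℓ                         ≤⟨ ℚ.*-monoˡ-≤-nonNeg v {{ℚ.nonNegative (ℚ.<⇒≤ (inv-pos w))}} (ℕ→ℚ-mono ℓ≤2kL) ⟩
    v * ℕ→ℚ (suc w ℕ.* L)             ≡⟨ cong (v *_) (ℕ→ℚ-* (suc w) L) ⟩
    v * (ℕ→ℚ (suc w) * ℕ→ℚ L)         ≡⟨ solve 3 (λ v w l → v :* (w :* l) := w :* v :* l) refl v (ℕ→ℚ (suc w)) (ℕ→ℚ L) ⟩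
    ℕ→ℚ (suc w) * v * ℕ→ℚ L           ≡⟨ cong (_* ℕ→ℚ L) (ℕ→ℚ-inv w) ⟩
    1ℚ * ℕ→ℚ L                        ≡⟨ ℚ.*-identityˡ (ℕ→ℚ L) ⟩
    ℕ→ℚ L                             ∎
    where
    open ℚ.≤-Reasoning
    open +-*-Solver
    w : ℕ
    w = k′ ℕ.+ (k ℕ.+ 0)
    v : ℚ
    v = inv w

  -- The least power of two whose logarithm meets the size condition of `batchSize`.
  threshold : ℕ
  threshold = 2 ℕ.^ (2 ℕ.* (suc b ℕ.+ k))

  module _ (T : ℕ) (threshold≤T : threshold ≤ T) where

    few : ∀ {L} → k ℕ.* L ℕ.+ b ℕ.< ⌊log₂ T ⌋ → ℕ→ℚ ((2 ℕ.^ k) ℕ.^ L) < ℕ→ℚ T * p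
    few {L} kL+b<ℓ = begin-strict
      N                                   ≡⟨ ℚ.*-identityʳ N ⟨
      N * 1ℚ                              ≤⟨ ℚ.*-monoˡ-≤-nonNeg N {{ℚ.nonNegative (ℕ→ℚ-nonneg ((2 ℕ.^ k) ℕ.^ L))}} 1≤p2^b ⟩
      N * (p * ℕ→ℚ (2 ℕ.^ b))             ≡⟨ solve 3 (λ n p c → n :* (p :* c) := n :* c :* p) refl N p (ℕ→ℚ (2 ℕ.^ b)) ⟩
      N * ℕ→ℚ (2 ℕ.^ b) * p               ≡⟨ cong (_* p) (ℕ→ℚ-* ((2 ℕ.^ k) ℕ.^ L) (2 ℕ.^ b)) ⟨
      ℕ→ℚ ((2 ℕ.^ k) ℕ.^ L ℕ.* 2 ℕ.^ b) * p <⟨ ℚ.*-monoˡ-<-pos p {{ℚ.positive 0<p}} (ℕ→ℚ-mono-< powers) ⟩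
      ℕ→ℚ T * p                           ∎
      where
      open ℚ.≤-Reasoning
      open +-*-Solver
      N : ℚ
      N = ℕ→ℚ ((2 ℕ.^ k) ℕ.^ L)
      powers : (2 ℕ.^ k) ℕ.^ L ℕ.* 2 ℕ.^ b ℕ.< T
      powers = ℕ.<-≤-trans
        (subst (ℕ._< 2 ℕ.^ ⌊log₂ T ⌋)
          (trans (ℕ.^-distribˡ-+-* 2 (k ℕ.* L) b) (cong (ℕ._* 2 ℕ.^ b) (sym (ℕ.^-*-assoc 2 k L))))
          (ℕ.^-monoʳ-< 2 (s≤s (s≤s z≤n)) kL+b<ℓ))
        (2^⌊log₂n⌋≤n T (ℕ.<-≤-trans (ℕ.m^n>0 2 (2 ℕ.* (suc b ℕ.+ k))) threshold≤T))

    log-large : 2 ℕ.* (suc b ℕ.+ k) ≤ ⌊log₂ T ⌋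
    log-large = subst (ℕ._≤ ⌊log₂ T ⌋) (⌊log₂[2^n]⌋≡n (2 ℕ.* (suc b ℕ.+ k))) (⌊log₂⌋-mono-≤ threshold≤T)

    logarithmicError : ∀ {Q} m i → (∀ L → Separates L m Q i) →
      PrivateErrorAtLeast ε β T Q (ℚ→ℝ (rate * ℕ→ℚ ⌊log₂ T ⌋))
    logarithmicError m i separates = go (batchSize k′ b ⌊log₂ T ⌋ log-large)
      where
      go : ∃[ L ] (k ℕ.* L ℕ.+ b ℕ.< ⌊log₂ T ⌋ × ⌊log₂ T ⌋ ≤ 2 ℕ.* k ℕ.* L) →
           PrivateErrorAtLeast ε β T _ (ℚ→ℝ (rate * ℕ→ℚ ⌊log₂ T ⌋))
      go (L , kL+b<ℓ , ℓ≤2kL) = privateErrorAtLeast L m ε β (separates L) (2 ℕ.^ k) (ℕ.m^n>0 2 k) exp≤2^k p p≤β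
        (few kL+b<ℓ) (rate * ℕ→ℚ ⌊log₂ T ⌋) (rate-upper ℓ≤2kL)

-- The five statistics and the choice of constants

AllErrorsAtLeast : ℝ → ℝ → ℕ → ℝ → Set₁
AllErrorsAtLeast ε β T b =
    (∀ τ → 1 ≤ τ → PrivateErrorAtLeast ε β T (highDegreeNodes τ) b)
  × PrivateErrorAtLeast ε β T degreeHistogram b
  × PrivateErrorAtLeast ε β T edgeCount b
  × PrivateErrorAtLeast ε β T triangleCount b
  × (∀ k → 1 ≤ k → PrivateErrorAtLeast ε β T (starCount k) b)

highDegreeNodes-separates : ∀ m L → Separates L m (highDegreeNodes (suc m)) tt
highDegreeNodes-separates m L G G′ n≡ n′≡ e≡ e′≡ = inj₁ (Gain.highDegreeNodes-gain L m G G′ n≡ n′≡ e≡ e′≡)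

degreeHistogram-separates : ∀ L → Separates L 0 degreeHistogram 0
degreeHistogram-separates L G G′ n≡ n′≡ e≡ e′≡ = inj₂ (isolated-loss L G G′ n≡ n′≡ e≡ e′≡)

edgeCount-separates : ∀ L → Separates L 0 edgeCount tt
edgeCount-separates L G G′ n≡ n′≡ e≡ e′≡ = inj₁ (Gain.edgeCount-gain L 0 G G′ n≡ n′≡ e≡ e′≡)

triangleCount-separates : ∀ L → Separates L 1 triangleCount tt
triangleCount-separates L G G′ n≡ n′≡ e≡ e′≡ = inj₁ (triangleCount-gain L G G′ n≡ n′≡ e≡ e′≡)

starCount-separates : ∀ m L → Separates L m (starCount (suc m)) tt
starCount-separates m L G G′ n≡ n′≡ e≡ e′≡ = inj₁ (Gain.starCount-gain L m G G′ n≡ n′≡ e≡ e′≡)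

theorem41 : ∀ (ε β : ℝ) → 0ℝ <ℝ ε → 0ℝ <ℝ β →
    ∃[ c ] (0ℝ <ℝ c × ∃[ T₀ ] (∀ T → T₀ ≤ T →
    let bound = c *ℝ ℕ→ℝ ⌊log₂ T ⌋ in
    (∀ τ → 1 ≤ τ → PrivateErrorAtLeast ε β T (highDegreeNodes τ) bound)
    × PrivateErrorAtLeast ε β T degreeHistogram bound
    × PrivateErrorAtLeast ε β T edgeCount bound
    × PrivateErrorAtLeast ε β T triangleCount bound
    × (∀ k → 1 ≤ k → PrivateErrorAtLeast ε β T (starCount k) bound)))
theorem41 ε β _ 0<β = choose (<ℝ⇒rational-lower {β} 0<β) (exp-upper ε)
  where
  Goal : Set₁
  Goal = ∃[ c ] (0ℝ <ℝ c × ∃[ T₀ ] (∀ T → T₀ ≤ T → AllErrorsAtLeast ε β T (c *ℝ ℕ→ℝ ⌊log₂ T ⌋)))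

  module _ (p : ℚ) (k′ b : ℕ)
           (0<p : 0ℚ < p) (p≤β : ℚ→ℝ p ≤ℝ β) (1≤p2^b : 1ℚ ≤ℚ p * ℕ→ℚ (2 ℕ.^ b))
           (exp≤2^k : Eventually (λ n → ∣ seq (exp ε) n ∣ ≤ℚ ℕ→ℚ (2 ℕ.^ suc k′))) where

    open LowerBound ε β k′ b p 0<p p≤β 1≤p2^b exp≤2^k

    bound : ∀ T → threshold ≤ T → ∀ {Q} m i → (∀ L → Separates L m Q i) →
            PrivateErrorAtLeast ε β T Q (ℚ→ℝ rate *ℝ ℕ→ℝ ⌊log₂ T ⌋)
    -- The product of reals and the embedded rational product carry different Cauchy proofs but the
    -- same `seq`, which is all that `_≤ℝ_` sees once applied to `δ`.
    bound T T₀≤T m i separates 𝒜 dp α accurate δ 0<δ = logarithmicError T T₀≤T m i separates 𝒜 dp α accurate δ 0<δ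

    conclude : Goal
    conclude = ℚ→ℝ rate , (rate , rate-pos , 0 , λ _ _ → ℚ.≤-reflexive (ℚ.+-identityˡ rate)) , threshold , λ T T₀≤T →
        -- One hub fewer than the threshold, and likewise than the star size, so that a single spoke
        -- tips the balance.
        (λ { (suc m) _ → bound T T₀≤T m tt (highDegreeNodes-separates m) })
      , bound T T₀≤T 0 0 degreeHistogram-separates
      , bound T T₀≤T 0 tt edgeCount-separates
      , bound T T₀≤T 1 tt triangleCount-separates
      , (λ { (suc m) _ → bound T T₀≤T m tt (starCount-separates m) })

  choose : ∃[ p ] (0ℚ < p × ℚ→ℝ p ≤ℝ β) → ∃[ k′ ] Eventually (λ n → ∣ seq (exp ε) n ∣ ≤ℚ ℕ→ℚ (2 ℕ.^ suc k′)) → Goal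
  choose (p , 0<p , p≤β) (k′ , exp≤2^k) = with-b (archimedean′ 1ℚ p 0<p)
    where
    with-b : ∃[ N ] 1ℚ ≤ℚ p * ℕ→ℚ N → Goal
    -- Taking b = N is crude, as N < 2^N, but b influences only the threshold on T and not the rate.
    with-b (N , 1≤pN) = conclude p k′ N 0<p p≤β (ℚ.≤-trans 1≤pN
      (ℚ.*-monoˡ-≤-nonNeg p {{ℚ.nonNegative (ℚ.<⇒≤ 0<p)}} (ℕ→ℚ-mono (ℕ.<⇒≤ (n<2^n N))))) exp≤2^k
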